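{- (i) Let $S\equiv\pm\{1, 5, 6, 8, 9, 13, 17, 21, 22, 25, 28, 29\}\pmod{60}$ and $T\equiv\pm\{1, 4, 5, 7, 13, 16, 17, 22, 23, 25, 26, 29\}\pmod{60}$. Then $p(S,n)=p(T,n-1)$ for all $n\geq 1$. (ii) Let $S\equiv\pm\{1, 2, 5, 7, 8, 11, 19, 23, 25, 26, 28, 29\}\pmod{60}$ and $T\equiv\pm\{1, 3, 4, 5, 7, 16, 18, 23, 25, 26, 27, 29\}\pmod{60}$. Then $p(S,n)=p(T,n)$ for all integers $n\ge0$ with $n\neq 2$. (iii) Let $S\equiv\pm\{2, 4, 5, 7, 11, 13, 14, 16, 17, 19, 23, 25\}\pmod{60}$ and $T\equiv\pm\{2, 5, 6, 7, 8, 9, 11, 19, 21, 23, 25, 28\}\pmod{60}$. Then $p(S,n)=p(T,n)$ for all integers $n\ge0$ with $n\neq 4$. (iv) Let $S\equiv\pm\{3, 4, 5, 11, 13, 14, 16, 17, 18, 19, 25, 27\}\pmod{60}$ and $T\equiv\pm\{1, 5, 8, 11, 13, 14, 17, 19, 22, 25, 28, 29\}\pmod{60}$. Then $p(S,n)=p(T,n-3)$ for all $n\geq 3$.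
   Context: For a set $S$ of positive integers and an integer $n\ge 0$, $p(S,n)$ denotes the number of partitions of $n$ into parts belonging to $S$ (so $p(S,0)=1$). The notation $S\equiv\pm\{r_1,\dots,r_k\}\pmod M$ means that $S$ is the set of all positive integers $n$ such that $n\equiv r_i$ or $n\equiv -r_i\pmod M$ for some $i$. -}

module Defs where

open import Data.Nat using (ℕ; zero; suc; _∸_; _≡ᵇ_; _%_; _<ᵇ_)
open import Data.Bool using (Bool; true; false; _∧_; _∨_)
open import Data.List using (List; []; _∷_; [_]; map; concatMap; filter; length; upTo)
open import Data.Bool.Properties using (T?)

NatSet : Set
NatSet = ℕ → Bool

anyB : {A : Set} → (A → Bool) → List A → Bool
anyB f []       = false
anyB f (x ∷ xs) = f x ∨ anyB f xs

allB : {A : Set} → (A → Bool) → List A → Bool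
allB f []       = true
allB f (x ∷ xs) = f x ∧ allB f xs

pm60 : List ℕ → NatSet
pm60 rs n =
  (0 <ᵇ n) ∧ anyB (λ r → (n % 60 ≡ᵇ r % 60) ∨ (n % 60 ≡ᵇ (60 ∸ (r % 60)) % 60)) rs

-- All partitions of n (as non-increasing lists of positive parts) whose parts are ≤ m.
-- The first argument is fuel; fuel ≥ n suffices since each part is ≥ 1.
partitionsBounded : (fuel n m : ℕ) → List (List ℕ)
partitionsBounded _        zero    _ = [ [] ]
partitionsBounded zero     (suc n) _ = []
partitionsBounded (suc f)  (suc n) m =
  concatMap (λ k → map (suc k ∷_) (partitionsBounded f (suc n ∸ suc k) (suc k)))
            (filter (λ k → T? ((k <ᵇ m) ∧ (k <ᵇ suc n))) (upTo (suc n)))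

partitions : ℕ → List (List ℕ)
partitions n = partitionsBounded n n n

p : NatSet → ℕ → ℕ
p S n = length (filter (λ ps → T? (allB S ps)) (partitions n))

{-# OPTIONS --safe #-}
module Submission where

-- With Φ_S = ∏_{s ∈ S} (1 − q^s), the generating function of p(S, ·) is 1 / Φ_S, so (i) and (iv)
-- amount to Φ_T = Φ_S Φ_T + q^e Φ_S, and (ii) and (iii) to Φ_T = Φ_S + q^e Φ_S Φ_T. Up to a common
-- factor each of these is a single instance of the three-term theta relation
--   D(s₁,s₃) D(s₂,s₄) + q^(s₂−s₃) D(s₁,s₂) D(s₃,s₄) = D(s₁,s₄) D(s₂,s₃),
-- where D(s,t) = J(s − t) J(s + t), J(a) = (± q^a, ± q^(30−a), q^30; q^30)_∞, and the sign in J is that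
-- of a product of two signs attached to s and t. The relation holds because, by Jacobi's triple product
-- and the substitution m = k − l, n = k + l (+ 1) in the double sum, D(s,t) is a 2 × 2 determinant.
-- Everything is done modulo q^N, so that q is nilpotent and all sums and products are finite.

open import Defs
open import Algebra.Bundles using (CommutativeMonoid; CommutativeSemiring)
import Algebra.Properties.CommutativeSemigroup as CommutativeSemigroupProperties
import Algebra.Properties.CommutativeSemiring.Exp as Exponent
import Algebra.Solver.Ring.NaturalCoefficients.Default as NaturalSolver
open import Algebra.Structures.Biased using (IsCommutativeSemiringˡ)
import Data.Bool as Bool
open import Data.Bool using (Bool; true; false; if_then_else_; _∧_; _∨_)
open import Data.Bool.Properties using (T?; T-≡)
open import Data.Empty using (⊥-elim)
open import Data.Integer as ℤ using (ℤ; +_; -[1+_]; ∣_∣; 0ℤ; 1ℤ; -1ℤ)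
import Data.Integer.Properties as ℤ
open import Data.Integer.Solver using (module +-*-Solver)
open import Data.List using (List; []; _∷_; _++_; map; concatMap; filter; foldr; length; upTo; applyUpTo)
import Data.List.Properties as List
open import Data.List.Relation.Binary.Permutation.Propositional as ↭ using (_↭_; prep; swap)
open import Data.List.Relation.Unary.All as All using (All; []; _∷_)
open import Data.List.Sort.Base using (module SortingAlgorithm)
open import Data.List.Sort.InsertionSort using (insertionSort)
open import Data.Nat using (ℕ; zero; suc; _≤_; _<_; _∸_; z≤n; s≤s; _≤?_; _<?_; _<ᵇ_; _≡ᵇ_)
import Data.Nat as ℕ
import Data.Nat.DivMod as ℕ
open import Data.Nat.ListAction using (sum)
import Data.Nat.Properties as ℕ
open import Data.Nat.Solver using () renaming (module +-*-Solver to ℕ-Solver)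
open import Data.Product using (_×_; _,_; ∃)
open import Data.Sign as Sign using (Sign)
open import Data.Sum using (_⊎_; inj₁; inj₂)
open import Function using (_∘_; Equivalence)
open import Level using (0ℓ)
open import Relation.Binary.PropositionalEquality as ≡ using (_≡_; _≢_)
import Relation.Binary.Reasoning.Setoid as SetoidReasoning
open import Relation.Binary.Structures using (IsEquivalence)
open import Relation.Nullary.Decidable using (True; toWitness)

open SortingAlgorithm (insertionSort ℕ.≤-decTotalOrder) using (sort; sort-↭)

-- The relation is Weierstrass's three-term theta relation. In the expansion of D(s,t) as H₁(s)
-- H₀(t) ± q^(s-t) H₀(s) H₁(t), the functions H₀ and H₁ are the same for both signs, so signs can be
-- attached to the four parameters freely. Opposite signs on s₂ and s₃ make all three terms of the
-- Plücker relation positive, as the partition identities require. Here s₁ and s₄ get opposite signs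
-- too, which leaves one binary choice. Some J then consist of factors 1 + q^k. Writing (-q^a; q^30)
-- as (q^(2a); q^60) / (q^a; q^30) turns the modulus 30 into 60, and the denominators so created
-- have to be cleared and cancelled again. Working modulo q^N removes all questions of convergence,
-- but q is then not invertible. Hence negative powers of q never occur: Jacobi's identity uses two
-- variables with z w = Q, and lemmas about exponents are parametrised so that all differences
-- become sums of natural numbers.

-- Finite sums and products in a commutative monoid

module BigOperator (M : CommutativeMonoid 0ℓ 0ℓ) where
  open CommutativeMonoid M
  open CommutativeSemigroupProperties commutativeSemigroup using (interchange)
  open SetoidReasoning setoid

  big : ℕ → (ℕ → Carrier) → Carrier
  big zero    f = ε
  big (suc n) f = big n f ∙ f n

  big-cong : ∀ n {f g} → (∀ i → i < n → f i ≈ g i) → big n f ≈ big n g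
  big-cong zero    f≈g = refl
  big-cong (suc n) f≈g = ∙-cong (big-cong n (λ i i<n → f≈g i (ℕ.m<n⇒m<1+n i<n))) (f≈g n (ℕ.n<1+n n))

  big-cong′ : ∀ n {f g} → (∀ i → f i ≈ g i) → big n f ≈ big n g
  big-cong′ n f≈g = big-cong n (λ i _ → f≈g i)

  big-ε : ∀ n {f} → (∀ i → i < n → f i ≈ ε) → big n f ≈ ε
  big-ε zero    f≈ε = refl
  big-ε (suc n) f≈ε = trans (∙-cong (big-ε n (λ i i<n → f≈ε i (ℕ.m<n⇒m<1+n i<n))) (f≈ε n (ℕ.n<1+n n)))
                            (identityʳ ε)

  big-∙ : ∀ n f g → big n (λ i → f i ∙ g i) ≈ big n f ∙ big n g
  big-∙ zero    f g = sym (identityʳ ε)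
  big-∙ (suc n) f g = trans (∙-congʳ (big-∙ n f g)) (interchange _ _ _ _)

  big-head : ∀ n f → big (suc n) f ≈ f 0 ∙ big n (f ∘ suc)
  big-head zero    f = comm ε (f 0)
  big-head (suc n) f = trans (∙-congʳ (big-head n f)) (assoc _ _ _)

  big-+ : ∀ m n f → big (m ℕ.+ n) f ≈ big m f ∙ big n (λ i → f (m ℕ.+ i))
  big-+ m zero    f rewrite ℕ.+-identityʳ m = sym (identityʳ _)
  big-+ m (suc n) f rewrite ℕ.+-suc m n = trans (∙-congʳ (big-+ m n f)) (assoc _ _ _)

  big-swap : ∀ m n (f : ℕ → ℕ → Carrier) → big m (λ i → big n (f i)) ≈ big n (λ j → big m (λ i → f i j))
  big-swap zero    n f = sym (big-ε n {λ _ → ε} (λ _ _ → refl))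
  big-swap (suc m) n f = trans (∙-congʳ (big-swap m n f)) (sym (big-∙ n (λ j → big m (λ i → f i j)) (f m)))

  big-blocks : ∀ n b f → big (n ℕ.* b) f ≈ big n (λ j → big b (λ i → f (j ℕ.* b ℕ.+ i)))
  big-blocks zero    b f = refl
  big-blocks (suc n) b f rewrite ℕ.+-comm b (n ℕ.* b) =
    trans (big-+ (n ℕ.* b) b f) (∙-congʳ (big-blocks n b f))

  big-prefix : ∀ m n f → (∀ i → f (m ℕ.+ i) ≈ ε) → big (m ℕ.+ n) f ≈ big m f
  big-prefix m n f f≈ε = trans (big-+ m n f) (trans (∙-congˡ (big-ε n (λ i _ → f≈ε i))) (identityʳ _))

-- Finite sums over ℤ

∣i-A∣≤A : ∀ {i A} → i ≤ A ℕ.+ A → ∣ + i ℤ.- + A ∣ ≤ A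
∣i-A∣≤A {i} {A} i≤2A rewrite ℤ.[+m]-[+n]≡m⊖n i A with ℕ.≤-total i A
... | inj₁ i≤A rewrite ℤ.∣⊖∣-≤ i≤A = ℕ.m∸n≤m A i
... | inj₂ A≤i rewrite ℤ.∣m⊖n∣≡∣n⊖m∣ i A | ℤ.∣⊖∣-≤ A≤i = ℕ.m≤n+o⇒m∸n≤o i A i≤2A

∣i∣≤∣i+j∣+∣j∣ : ∀ i j → ∣ i ∣ ≤ ∣ i ℤ.+ j ∣ ℕ.+ ∣ j ∣
∣i∣≤∣i+j∣+∣j∣ i j = ≡.subst (λ k → ∣ k ∣ ≤ ∣ i ℤ.+ j ∣ ℕ.+ ∣ j ∣)
  (solve 2 (λ i j → i :+ j :- j := i) ≡.refl i j) (ℤ.∣i-j∣≤∣i∣+∣j∣ (i ℤ.+ j) j)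
  where open +-*-Solver

shift-bound : ∀ {M} k c → ∣ c ∣ ≤ 1 → suc M ≤ ∣ k ∣ → M ≤ ∣ k ℤ.+ c ∣
shift-bound {M} k c ∣c∣≤1 1+M≤k = ℕ.+-cancelʳ-≤ 1 M _ (begin
  M ℕ.+ 1                  ≡⟨ ℕ.+-comm M 1 ⟩
  suc M                    ≤⟨ 1+M≤k ⟩
  ∣ k ∣                    ≤⟨ ∣i∣≤∣i+j∣+∣j∣ k c ⟩
  ∣ k ℤ.+ c ∣ ℕ.+ ∣ c ∣    ≤⟨ ℕ.+-monoʳ-≤ ∣ k ℤ.+ c ∣ ∣c∣≤1 ⟩
  ∣ k ℤ.+ c ∣ ℕ.+ 1        ∎)
  where open ℕ.≤-Reasoning

module IntegerSum (M : CommutativeMonoid 0ℓ 0ℓ) where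
  open CommutativeMonoid M
  open BigOperator M
  open SetoidReasoning setoid

  -- The range is half-open, -A ≤ k < A: an even number of terms, so that `box-even-odd` splits the
  -- box of size 2A exactly into two ranges of the same shape.
  box : ℕ → (ℤ → Carrier) → Carrier
  box A g = big (A ℕ.+ A) (λ i → g (+ i ℤ.- + A))

  VanishesFrom : ℕ → (ℤ → Carrier) → Set
  VanishesFrom M g = ∀ k → M ≤ ∣ k ∣ → g k ≈ ε

  box-cong : ∀ A {f g} → (∀ k → ∣ k ∣ ≤ A → f k ≈ g k) → box A f ≈ box A g
  box-cong A f≈g = big-cong (A ℕ.+ A) (λ i i<2A → f≈g _ (∣i-A∣≤A (ℕ.<⇒≤ i<2A)))

  box-∙ : ∀ A f g → box A (λ k → f k ∙ g k) ≈ box A f ∙ box A g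
  box-∙ A f g = big-∙ (A ℕ.+ A) _ _

  box-swap : ∀ A B (f : ℤ → ℤ → Carrier) → box A (λ k → box B (f k)) ≈ box B (λ l → box A (λ k → f k l))
  box-swap A B f = big-swap (A ℕ.+ A) (B ℕ.+ B) (λ i j → f (+ i ℤ.- + A) (+ j ℤ.- + B))

  private
    vanishes-shift : ∀ {M g} c → ∣ c ∣ ≤ 1 → VanishesFrom M g → VanishesFrom (suc M) (λ k → g (k ℤ.+ c))
    vanishes-shift c ∣c∣≤1 g≈ε k 1+M≤k = g≈ε (k ℤ.+ c) (shift-bound k c ∣c∣≤1 1+M≤k)

    ends : ∀ n (h : ℕ → Carrier) → h 0 ≈ ε → h n ≈ ε → big n (h ∘ suc) ≈ big n h
    ends n h h0≈ε hn≈ε = begin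
      big n (h ∘ suc)            ≈⟨ identityˡ _ ⟨
      ε ∙ big n (h ∘ suc)        ≈⟨ ∙-congʳ h0≈ε ⟨
      h 0 ∙ big n (h ∘ suc)      ≈⟨ big-head n h ⟨
      big n h ∙ h n              ≈⟨ ∙-congˡ hn≈ε ⟩
      big n h ∙ ε                ≈⟨ identityʳ _ ⟩
      big n h                    ∎

    i+1-A : ∀ i A → + i ℤ.- + A ℤ.+ ℤ.1ℤ ≡ + suc i ℤ.- + A
    i+1-A i A = solve 2 (λ i a → i :- a :+ con ℤ.1ℤ := con ℤ.1ℤ :+ i :- a) ≡.refl (+ i) (+ A)
      where open +-*-Solver

    low : ∀ A → ∣ + 0 ℤ.- + A ∣ ≡ A
    low zero    = ≡.refl
    low (suc A) = ≡.refl

    high : ∀ A → ∣ + (A ℕ.+ A) ℤ.- + A ∣ ≡ A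
    high A = ≡.cong ∣_∣ (solve 1 (λ a → a :+ a :- a := a) ≡.refl (+ A))
      where open +-*-Solver

    shift₁ : ∀ {A M g} → M ≤ A → VanishesFrom M g → box A (λ k → g (k ℤ.+ ℤ.1ℤ)) ≈ box A g
    shift₁ {A} {M} {g} M≤A g≈ε = trans
      (big-cong′ (A ℕ.+ A) (λ i → reflexive (≡.cong g (i+1-A i A))))
      (ends (A ℕ.+ A) (λ i → g (+ i ℤ.- + A))
        (g≈ε _ (≡.subst (M ≤_) (≡.sym (low A)) M≤A))
        (g≈ε _ (≡.subst (M ≤_) (≡.sym (high A)) M≤A)))

  -- The shift is made one unit at a time. Each unit drops one end value and adds the other; it also
  -- enlarges the bound of vanishing by at most one, and `M + ∣c∣ ≤ A` pays for all units together.
  box-shift : ∀ {A M g} c → VanishesFrom M g → M ℕ.+ ∣ c ∣ ≤ A → box A (λ k → g (k ℤ.+ c)) ≈ box A g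
  box-shift {A} {M} {g} (+ n) = up n
    where
    up : ∀ n {M g} → VanishesFrom M g → M ℕ.+ n ≤ A → box A (λ k → g (k ℤ.+ + n)) ≈ box A g
    up zero    {g = g} _ _ = box-cong A (λ k _ → reflexive (≡.cong g (ℤ.+-identityʳ k)))
    up (suc n) {M} {g} g≈ε M+1+n≤A = begin
      box A (λ k → g (k ℤ.+ + suc n))              ≈⟨ box-cong A (λ k _ → reflexive (≡.cong g (assoc′ k))) ⟩
      box A (λ k → g (k ℤ.+ + n ℤ.+ ℤ.1ℤ))         ≈⟨ up n (vanishes-shift ℤ.1ℤ (s≤s z≤n) g≈ε) 1+M+n≤A ⟩
      box A (λ k → g (k ℤ.+ ℤ.1ℤ))                 ≈⟨ shift₁ (ℕ.≤-trans (ℕ.m≤m+n M (suc n)) M+1+n≤A) g≈ε ⟩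
      box A g                                      ∎
      where
      1+M+n≤A = ≡.subst (_≤ A) (ℕ.+-suc M n) M+1+n≤A
      assoc′ : ∀ k → k ℤ.+ + suc n ≡ k ℤ.+ + n ℤ.+ ℤ.1ℤ
      assoc′ k = solve 2 (λ k n → k :+ (con ℤ.1ℤ :+ n) := k :+ n :+ con ℤ.1ℤ) ≡.refl k (+ n)
        where open +-*-Solver
  box-shift {A} {M} {g} -[1+ n ] = down (suc n)
    where
    down : ∀ n {M g} → VanishesFrom M g → M ℕ.+ n ≤ A → box A (λ k → g (k ℤ.+ ℤ.- + n)) ≈ box A g
    down zero    {g = g} _ _ = box-cong A (λ k _ → reflexive (≡.cong g (ℤ.+-identityʳ k)))
    down (suc n) {M} {g} g≈ε M+1+n≤A = begin
      box A (λ k → g (k ℤ.+ ℤ.- + suc n))              ≈⟨ box-cong A (λ k _ → reflexive (≡.cong g (assoc′ k))) ⟩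
      box A (λ k → g (k ℤ.+ ℤ.- + n ℤ.+ ℤ.-1ℤ))        ≈⟨ down n g′≈ε 1+M+n≤A ⟩
      -- A unit shift down is the unit shift up of k ↦ g (k - 1), read backwards.
      box A (λ k → g (k ℤ.+ ℤ.-1ℤ))                    ≈⟨ shift₁ (ℕ.≤-trans (ℕ.m≤m+n (suc M) n) 1+M+n≤A) g′≈ε ⟨
      box A (λ k → g (k ℤ.+ ℤ.1ℤ ℤ.+ ℤ.-1ℤ))           ≈⟨ box-cong A (λ k _ → reflexive (≡.cong g (cancel k))) ⟩
      box A g                                          ∎
      where
      g′≈ε = vanishes-shift ℤ.-1ℤ (s≤s z≤n) g≈ε
      1+M+n≤A = ≡.subst (_≤ A) (ℕ.+-suc M n) M+1+n≤A
      open +-*-Solver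
      assoc′ : ∀ k → k ℤ.+ ℤ.- + suc n ≡ k ℤ.+ ℤ.- + n ℤ.+ ℤ.-1ℤ
      assoc′ k = solve 2 (λ k n → k :+ (:- (con ℤ.1ℤ :+ n)) := k :+ (:- n) :+ con ℤ.-1ℤ) ≡.refl k (+ n)
      cancel : ∀ k → k ℤ.+ ℤ.1ℤ ℤ.+ ℤ.-1ℤ ≡ k
      cancel k = solve 1 (λ k → k :+ con ℤ.1ℤ :+ con ℤ.-1ℤ := k) ≡.refl k

  box-extend : ∀ {A M g} → VanishesFrom M g → M ≤ A → box A g ≈ box M g
  box-extend {A} {M} {g} g≈ε M≤A = ≡.subst (λ A → box A g ≈ box M g) (ℕ.m∸n+n≡m M≤A) (grow (A ∸ M))
    where
    step : ∀ A → M ≤ A → box (suc A) g ≈ box A g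
    step A M≤A = begin
      box (suc A) g                                        ≡⟨ ≡.cong (λ n → big n h) (ℕ.+-suc (suc A) A) ⟩
      big (suc (A ℕ.+ A)) h ∙ h (suc (A ℕ.+ A))            ≈⟨ ∙-congˡ (g≈ε _ (≡.subst (M ≤_) (≡.sym top) M≤A)) ⟩
      big (suc (A ℕ.+ A)) h ∙ ε                            ≈⟨ identityʳ _ ⟩
      big (suc (A ℕ.+ A)) h                                ≈⟨ big-head (A ℕ.+ A) h ⟩
      h 0 ∙ big (A ℕ.+ A) (h ∘ suc)                        ≈⟨ ∙-congʳ (g≈ε _ (ℕ.m≤n⇒m≤1+n M≤A)) ⟩
      ε ∙ big (A ℕ.+ A) (h ∘ suc)                          ≈⟨ identityˡ _ ⟩
      big (A ℕ.+ A) (h ∘ suc)                              ≈⟨ big-cong′ (A ℕ.+ A) (λ i → reflexive (≡.cong g (sucs i))) ⟩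
      box A g                                              ∎
      where
      open +-*-Solver
      h : ℕ → Carrier
      h i = g (+ i ℤ.- + suc A)
      top : ∣ + suc (A ℕ.+ A) ℤ.- + suc A ∣ ≡ A
      top = ≡.cong ∣_∣ (solve 1 (λ a → con ℤ.1ℤ :+ (a :+ a) :- (con ℤ.1ℤ :+ a) := a) ≡.refl (+ A))
      sucs : ∀ i → + suc i ℤ.- + suc A ≡ + i ℤ.- + A
      sucs i = solve 2 (λ i a → con ℤ.1ℤ :+ i :- (con ℤ.1ℤ :+ a) := i :- a) ≡.refl (+ i) (+ A)
    grow : ∀ d → box (d ℕ.+ M) g ≈ box M g
    grow zero    = refl
    grow (suc d) = trans (step (d ℕ.+ M) (ℕ.m≤n+m M d)) (grow d)

  box-even-odd : ∀ A g → box (A ℕ.+ A) g ≈ box A (λ l → g (l ℤ.+ l)) ∙ box A (λ l → g (l ℤ.+ l ℤ.+ ℤ.1ℤ))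
  box-even-odd A g = begin
    big (A ℕ.+ A ℕ.+ (A ℕ.+ A)) h                          ≡⟨ ≡.cong (λ n → big n h) double ⟩
    big ((A ℕ.+ A) ℕ.* 2) h                                ≈⟨ big-blocks (A ℕ.+ A) 2 h ⟩
    big (A ℕ.+ A) (λ j → ε ∙ h (j ℕ.* 2 ℕ.+ 0) ∙ h (j ℕ.* 2 ℕ.+ 1))
      ≈⟨ big-cong′ (A ℕ.+ A) (λ j → ∙-cong (trans (identityˡ _) (reflexive (≡.cong g (index j 0)))) (reflexive (≡.cong g (index j 1)))) ⟩
    big (A ℕ.+ A) (λ j → g (k j ℤ.+ k j ℤ.+ + 0) ∙ g (k j ℤ.+ k j ℤ.+ + 1))
      ≈⟨ big-∙ (A ℕ.+ A) _ _ ⟩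
    big (A ℕ.+ A) (λ j → g (k j ℤ.+ k j ℤ.+ + 0)) ∙ box A (λ l → g (l ℤ.+ l ℤ.+ ℤ.1ℤ))
      ≈⟨ ∙-congʳ (big-cong′ (A ℕ.+ A) (λ j → reflexive (≡.cong g (ℤ.+-identityʳ (k j ℤ.+ k j))))) ⟩
    box A (λ l → g (l ℤ.+ l)) ∙ box A (λ l → g (l ℤ.+ l ℤ.+ ℤ.1ℤ)) ∎
    where
    h : ℕ → Carrier
    h i = g (+ i ℤ.- + (A ℕ.+ A))
    k : ℕ → ℤ
    k j = + j ℤ.- + A
    double : A ℕ.+ A ℕ.+ (A ℕ.+ A) ≡ (A ℕ.+ A) ℕ.* 2
    double = ≡.trans (≡.cong (A ℕ.+ A ℕ.+_) (≡.sym (ℕ.+-identityʳ (A ℕ.+ A)))) (ℕ.*-comm 2 (A ℕ.+ A))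
    index : ∀ j i → + (j ℕ.* 2 ℕ.+ i) ℤ.- + (A ℕ.+ A) ≡ k j ℤ.+ k j ℤ.+ + i
    index j i = ≡.trans (≡.cong (λ x → x ℤ.+ + i ℤ.- + (A ℕ.+ A)) (ℤ.pos-* j 2))
      (solve 3 (λ j a i → j :* con (+ 2) :+ i :- (a :+ a) := j :- a :+ (j :- a) :+ i) ≡.refl (+ j) (+ A) (+ i))
      where open +-*-Solver

  -- The substitution m = k − l, n = k + l (+ 1), according to the parity of n − m.
  box-rotate : ∀ {M} {f : ℤ → ℤ → Carrier} → (∀ m n → M ≤ ∣ m ∣ ⊎ M ≤ ∣ n ∣ → f m n ≈ ε) →
    let A = M ℕ.+ M; B = M ℕ.+ A in
    box B (λ m → box (A ℕ.+ A) (f m))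
      ≈ box A (λ l → box B (λ k → f (k ℤ.- l) (k ℤ.+ l)))
      ∙ box A (λ l → box B (λ k → f (k ℤ.- l) (k ℤ.+ l ℤ.+ ℤ.1ℤ)))
  box-rotate {M} {f} f≈ε = begin
    box B (λ m → box (A ℕ.+ A) (f m))
      -- The sizes 3M and 4M are forced here: n is shifted by up to B, and M + B = A + A; later m is
      -- shifted by up to A, and M + A = B.
      ≈⟨ box-cong B (λ m ∣m∣≤B → trans
           (sym (box-shift {g = f m} m (λ n M≤n → f≈ε m n (inj₂ M≤n)) (≡.subst (M ℕ.+ ∣ m ∣ ≤_) (≡.sym (ℕ.+-assoc M M A)) (ℕ.+-monoʳ-≤ M ∣m∣≤B))))
           (box-even-odd A (λ n → f m (n ℤ.+ m)))) ⟩
    box B (λ m → box A (λ l → f m (l ℤ.+ l ℤ.+ m)) ∙ box A (λ l → f m (l ℤ.+ l ℤ.+ ℤ.1ℤ ℤ.+ m)))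
      ≈⟨ box-∙ B (λ m → box A (λ l → f m (l ℤ.+ l ℤ.+ m))) (λ m → box A (λ l → f m (l ℤ.+ l ℤ.+ ℤ.1ℤ ℤ.+ m))) ⟩
    box B (λ m → box A (λ l → f m (l ℤ.+ l ℤ.+ m))) ∙ box B (λ m → box A (λ l → f m (l ℤ.+ l ℤ.+ ℤ.1ℤ ℤ.+ m)))
      ≈⟨ ∙-cong (box-swap B A (λ m l → f m (l ℤ.+ l ℤ.+ m))) (box-swap B A (λ m l → f m (l ℤ.+ l ℤ.+ ℤ.1ℤ ℤ.+ m))) ⟩
    box A (λ l → box B (λ m → f m (l ℤ.+ l ℤ.+ m))) ∙ box A (λ l → box B (λ m → f m (l ℤ.+ l ℤ.+ ℤ.1ℤ ℤ.+ m)))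
      ≈⟨ ∙-cong (box-cong A (λ l ∣l∣≤A → shear (λ m → l ℤ.+ l ℤ.+ m) (λ k → k ℤ.+ l) l ∣l∣≤A
                  (λ k → solve 2 (λ k l → l :+ l :+ (k :- l) := k :+ l) ≡.refl k l)))
                (box-cong A (λ l ∣l∣≤A → shear (λ m → l ℤ.+ l ℤ.+ ℤ.1ℤ ℤ.+ m) (λ k → k ℤ.+ l ℤ.+ ℤ.1ℤ) l ∣l∣≤A
                  (λ k → solve 2 (λ k l → l :+ l :+ con ℤ.1ℤ :+ (k :- l) := k :+ l :+ con ℤ.1ℤ) ≡.refl k l))) ⟩
    box A (λ l → box B (λ k → f (k ℤ.- l) (k ℤ.+ l))) ∙ box A (λ l → box B (λ k → f (k ℤ.- l) (k ℤ.+ l ℤ.+ ℤ.1ℤ))) ∎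
    where
    open +-*-Solver
    A = M ℕ.+ M
    B = M ℕ.+ A
    shear : ∀ (u v : ℤ → ℤ) l → ∣ l ∣ ≤ A → (∀ k → u (k ℤ.- l) ≡ v k) →
            box B (λ m → f m (u m)) ≈ box B (λ k → f (k ℤ.- l) (v k))
    shear u v l ∣l∣≤A u≡v = begin
      box B (λ m → f m (u m))
        ≈⟨ box-shift {g = λ m → f m (u m)} (ℤ.- l) (λ m M≤m → f≈ε m (u m) (inj₁ M≤m))
             (ℕ.+-monoʳ-≤ M (≡.subst (_≤ A) (≡.sym (ℤ.∣-i∣≡∣i∣ l)) ∣l∣≤A)) ⟨
      box B (λ k → f (k ℤ.- l) (u (k ℤ.- l)))
        ≈⟨ box-cong B (λ k _ → reflexive (≡.cong (f (k ℤ.- l)) (u≡v k))) ⟩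
      box B (λ k → f (k ℤ.- l) (v k)) ∎

-- Jacobi's triple product

-- This is n(n - 1)/2, not n(n + 1)/2.
triangle : ℕ → ℕ
triangle zero    = 0
triangle (suc n) = n ℕ.+ triangle n

module Antidiagonal (M : CommutativeMonoid 0ℓ 0ℓ) where
  open CommutativeMonoid M
  open BigOperator M
  open SetoidReasoning setoid

  -- Passing both a and b to the summand keeps the truncated difference n - a out of the binomial
  -- sums.
  antidiagonal : ℕ → (ℕ → ℕ → Carrier) → Carrier
  antidiagonal zero    F = F 0 0
  antidiagonal (suc n) F = F 0 (suc n) ∙ antidiagonal n (λ a b → F (suc a) b)

  antidiagonal-cong : ∀ n {F G} → (∀ a b → a ℕ.+ b ≡ n → F a b ≈ G a b) → antidiagonal n F ≈ antidiagonal n G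
  antidiagonal-cong zero    F≈G = F≈G 0 0 ≡.refl
  antidiagonal-cong (suc n) F≈G = ∙-cong (F≈G 0 (suc n) ≡.refl)
    (antidiagonal-cong n (λ a b a+b≡n → F≈G (suc a) b (≡.cong suc a+b≡n)))

  antidiagonal-last : ∀ n F → antidiagonal (suc n) F ≈ antidiagonal n (λ a b → F a (suc b)) ∙ F (suc n) 0
  antidiagonal-last zero    F = refl
  antidiagonal-last (suc n) F = trans (∙-congˡ (antidiagonal-last n (λ a b → F (suc a) b))) (sym (assoc _ _ _))

  antidiagonal-∙ : ∀ n F G → antidiagonal n (λ a b → F a b ∙ G a b) ≈ antidiagonal n F ∙ antidiagonal n G
  antidiagonal-∙ zero    F G = refl
  antidiagonal-∙ (suc n) F G = trans (∙-congˡ (antidiagonal-∙ n _ _)) (interchange _ _ _ _)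
    where open CommutativeSemigroupProperties commutativeSemigroup using (interchange)

  antidiagonal-big : ∀ n f → antidiagonal n (λ a _ → f a) ≈ big (suc n) f
  antidiagonal-big zero    f = sym (identityˡ (f 0))
  antidiagonal-big (suc n) f = trans (∙-congˡ (antidiagonal-big n (f ∘ suc))) (sym (big-head (suc n) f))

  -- An interior entry of row `suc n` has two parents in row `n`; a boundary entry has only one, in
  -- `H` where a = 0 and in `K` where b = 0. Both q-Pascal rules are summed in this way.
  antidiagonal-pascal : ∀ n F H K → (∀ b → F 0 (suc b) ≈ H 0 b) → (∀ a → F (suc a) 0 ≈ K a 0) →
    (∀ a b → F (suc a) (suc b) ≈ H (suc a) b ∙ K a (suc b)) →
    antidiagonal (suc n) F ≈ antidiagonal n H ∙ antidiagonal n K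
  antidiagonal-pascal zero    F H K left right inner = ∙-cong (left 0) (right 0)
  antidiagonal-pascal (suc n) F H K left right inner = begin
    F 0 (suc (suc n)) ∙ antidiagonal (suc n) (λ a b → F (suc a) b)
      ≈⟨ ∙-cong (left (suc n)) (antidiagonal-last n (λ a b → F (suc a) b)) ⟩
    H 0 (suc n) ∙ (antidiagonal n (λ a b → F (suc a) (suc b)) ∙ F (suc (suc n)) 0)
      ≈⟨ ∙-congˡ (∙-cong (trans (antidiagonal-cong n (λ a b _ → inner a b)) (antidiagonal-∙ n (λ a b → H (suc a) b) (λ a b → K a (suc b)))) (right (suc n))) ⟩
    H 0 (suc n) ∙ (antidiagonal n (λ a b → H (suc a) b) ∙ antidiagonal n (λ a b → K a (suc b)) ∙ K (suc n) 0)
      ≈⟨ ∙-congˡ (assoc _ _ _) ⟩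
    H 0 (suc n) ∙ (antidiagonal n (λ a b → H (suc a) b) ∙ (antidiagonal n (λ a b → K a (suc b)) ∙ K (suc n) 0))
      ≈⟨ assoc _ _ _ ⟨
    antidiagonal (suc n) H ∙ (antidiagonal n (λ a b → K a (suc b)) ∙ K (suc n) 0)
      ≈⟨ ∙-congˡ (antidiagonal-last n K) ⟨
    antidiagonal (suc n) H ∙ antidiagonal (suc n) K ∎

-- An explicit −1 makes all identities below semiring identities, hence accessible to the solver.
IsMinusOne : (R : CommutativeSemiring 0ℓ 0ℓ) → CommutativeSemiring.Carrier R → Set
IsMinusOne R ν = 1# + ν ≈ 0#
  where open CommutativeSemiring R

IsNilpotent : (R : CommutativeSemiring 0ℓ 0ℓ) → ℕ → CommutativeSemiring.Carrier R → Set
IsNilpotent R N x = x ^ N ≈ 0#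
  where
  open CommutativeSemiring R
  open Exponent R

module Nilpotent (R : CommutativeSemiring 0ℓ 0ℓ) (ν : CommutativeSemiring.Carrier R)
                 (1+ν≈0 : IsMinusOne R ν) (N : ℕ) where
  open CommutativeSemiring R
  open Exponent R
  open SetoidReasoning setoid
  open NaturalSolver R using (solve; _:=_; _:+_; _:*_; con)
  module Sum = BigOperator +-commutativeMonoid
  module Product = BigOperator *-commutativeMonoid
  open Sum public using () renaming (big to ∑)
  open Product public using () renaming (big to ∏)
  open Antidiagonal +-commutativeMonoid
  open IntegerSum +-commutativeMonoid

  -- This replaces subtraction: calls to the semiring solver are arranged so that everything that
  -- should cancel is collected in one multiple of `1# + ν`.
  cancel-ν : ∀ x y → x + (1# + ν) * y ≈ x
  cancel-ν x y = trans (+-congˡ (trans (*-congʳ 1+ν≈0) (zeroˡ y))) (+-identityʳ x)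

  ν²≈1 : ν * ν ≈ 1#
  ν²≈1 = begin
    ν * ν                        ≈⟨ cancel-ν (ν * ν) 1# ⟨
    ν * ν + (1# + ν) * 1#        ≈⟨ solve 1 (λ v → v :* v :+ (con 1 :+ v) :* con 1 := con 1 :+ (con 1 :+ v) :* v) refl ν ⟩
    1# + (1# + ν) * ν            ≈⟨ cancel-ν 1# ν ⟩
    1#                           ∎

  ^-swap : ∀ x m n → (x ^ m) ^ n ≈ (x ^ n) ^ m
  ^-swap x m n = trans (^-assocʳ x m n) (trans (^-congʳ x (ℕ.*-comm m n)) (sym (^-assocʳ x n m)))

  Nil : Carrier → Set
  Nil = IsNilpotent R N

  nil-^ : ∀ {x} n → Nil x → Nil (x ^ suc n)
  nil-^ {x} n x^N≈0 = trans (^-swap x (suc n) N) (trans (^-congˡ (suc n) x^N≈0) (zeroˡ _))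

  nil-≥ : ∀ {x n} → Nil x → N ≤ n → x ^ n ≈ 0#
  nil-≥ {x} {n} x^N≈0 N≤n = begin
    x ^ n                    ≈⟨ ^-congʳ x (ℕ.m+[n∸m]≡n N≤n) ⟨
    x ^ (N ℕ.+ (n ∸ N))      ≈⟨ ^-homo-* x N (n ∸ N) ⟩
    x ^ N * x ^ (n ∸ N)      ≈⟨ *-congʳ x^N≈0 ⟩
    0# * x ^ (n ∸ N)         ≈⟨ zeroˡ _ ⟩
    0#                       ∎

  geometric : Carrier → Carrier
  geometric x = ∑ N (x ^_)

  1-x*geometric : ∀ {x} → Nil x → (1# + ν * x) * geometric x ≈ 1#
  1-x*geometric {x} x^N≈0 = begin
    (1# + ν * x) * geometric x     ≈⟨ telescope N ⟩
    1# + ν * x ^ N                 ≈⟨ +-congˡ (trans (*-congˡ x^N≈0) (zeroʳ ν)) ⟩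
    1# + 0#                        ≈⟨ +-identityʳ 1# ⟩
    1#                             ∎
    where
    telescope : ∀ n → (1# + ν * x) * ∑ n (x ^_) ≈ 1# + ν * x ^ n
    telescope zero    = trans (zeroʳ _) (trans (sym 1+ν≈0) (+-congˡ (sym (*-identityʳ ν))))
    telescope (suc n) = begin
      (1# + ν * x) * (∑ n (x ^_) + x ^ n)
        ≈⟨ distribˡ _ _ _ ⟩
      (1# + ν * x) * ∑ n (x ^_) + (1# + ν * x) * x ^ n
        ≈⟨ +-congʳ (telescope n) ⟩
      1# + ν * x ^ n + (1# + ν * x) * x ^ n
        ≈⟨ solve 3 (λ v x y → con 1 :+ v :* y :+ (con 1 :+ v :* x) :* y := con 1 :+ v :* (x :* y) :+ (con 1 :+ v) :* y) refl ν x (x ^ n) ⟩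
      1# + ν * (x * x ^ n) + (1# + ν) * x ^ n
        ≈⟨ cancel-ν _ _ ⟩
      1# + ν * (x * x ^ n) ∎

  antidiagonal-*ʳ : ∀ n F x → antidiagonal n F * x ≈ antidiagonal n (λ a b → F a b * x)
  antidiagonal-*ʳ zero    F x = refl
  antidiagonal-*ʳ (suc n) F x = trans (distribʳ x _ _) (+-congˡ (antidiagonal-*ʳ n _ x))

  -- `w` plays the role of Q/z. In the application z is ± q^c with c ≥ 1, hence nilpotent, and the
  -- quotient does not exist.
  module JacobiTripleProduct (z w Q : Carrier) (zw≈Q : z * w ≈ Q) (Q^N≈0 : Nil Q) where

    P I : ℕ → Carrier
    P n = ∏ n (λ i → 1# + ν * Q ^ suc i)
    I n = ∏ n (λ i → geometric (Q ^ suc i))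

    P*I : ∀ n → P n * I n ≈ 1#
    P*I n = trans (sym (Product.big-∙ n _ _)) (Product.big-ε n (λ i _ → 1-x*geometric (nil-^ i Q^N≈0)))

    P-stable : ∀ {n} → N ≤ n → P n ≈ P N
    P-stable {n} N≤n = ≡.subst (λ n → P n ≈ P N) (ℕ.m+[n∸m]≡n N≤n) (Product.big-prefix N (n ∸ N) _
      (λ i → trans (+-congˡ (trans (*-congˡ (nil-≥ Q^N≈0 (ℕ.m≤n⇒m≤1+n (ℕ.m≤m+n N i)))) (zeroʳ ν))) (+-identityʳ 1#)))

    I-stable : ∀ {n} → N ≤ n → I n ≈ I N
    I-stable {n} N≤n = begin
      I n                    ≈⟨ *-identityˡ _ ⟨
      1# * I n               ≈⟨ *-congʳ (P*I N) ⟨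
      P N * I N * I n        ≈⟨ *-congʳ (*-congʳ (P-stable N≤n)) ⟨
      P n * I N * I n        ≈⟨ solve 3 (λ p x y → p :* x :* y := p :* y :* x) refl (P n) (I N) (I n) ⟩
      P n * I n * I N        ≈⟨ *-congʳ (P*I n) ⟩
      1# * I N               ≈⟨ *-identityˡ _ ⟩
      I N                    ∎

    -- The Gaussian binomial coefficient [a + b choose a].
    gauss : ℕ → ℕ → Carrier
    gauss a b = P (a ℕ.+ b) * (I a * I b)

    gauss-comm : ∀ a b → gauss a b ≈ gauss b a
    gauss-comm a b = *-cong (reflexive (≡.cong P (ℕ.+-comm a b))) (*-comm _ _)

    gauss-0ˡ : ∀ b → gauss 0 b ≈ 1#
    gauss-0ˡ b = trans (*-congˡ (*-identityˡ _)) (P*I b)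

    gauss-0ʳ : ∀ a → gauss a 0 ≈ 1#
    gauss-0ʳ a = trans (gauss-comm a 0) (gauss-0ˡ a)

    -- With x = Q^(a+1) and y = Q^(b+1), the top factor of `P` splits as 1 - x y = (1 - x) + x (1 -
    -- y), and each summand cancels the last factor of `I (suc a)` or of `I (suc b)`.
    gauss-pascal : ∀ a b → gauss (suc a) (suc b) ≈ gauss a (suc b) + Q ^ suc a * gauss (suc a) b
    gauss-pascal a b = begin
      c * (1# + ν * Q ^ (suc a ℕ.+ suc b)) * (I a * g * (I b * h))
        ≈⟨ *-congʳ (*-congˡ (+-congˡ (*-congˡ (^-homo-* Q (suc a) (suc b))))) ⟩
      c * (1# + ν * (x * y)) * (I a * g * (I b * h))
        ≈⟨ *-congʳ (*-congˡ (cancel-ν _ x)) ⟨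
      c * (1# + ν * (x * y) + (1# + ν) * x) * (I a * g * (I b * h))
        ≈⟨ solve 8 (λ c v x y i g j h → c :* (con 1 :+ v :* (x :* y) :+ (con 1 :+ v) :* x) :* (i :* g :* (j :* h))
                     := c :* (i :* (j :* h)) :* ((con 1 :+ v :* x) :* g) :+ x :* (c :* (i :* g :* j) :* ((con 1 :+ v :* y) :* h)))
             refl c ν x y (I a) g (I b) h ⟩
      c * (I a * (I b * h)) * ((1# + ν * x) * g) + x * (c * (I a * g * I b) * ((1# + ν * y) * h))
        ≈⟨ +-cong (*-congˡ (1-x*geometric (nil-^ a Q^N≈0))) (*-congˡ (*-congˡ (1-x*geometric (nil-^ b Q^N≈0)))) ⟩
      c * (I a * (I b * h)) * 1# + x * (c * (I a * g * I b) * 1#)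
        ≈⟨ +-cong (*-identityʳ _) (*-congˡ (*-identityʳ _)) ⟩
      gauss a (suc b) + x * (c * (I a * g * I b))
        ≈⟨ +-congˡ (*-congˡ (*-congʳ (reflexive (≡.cong P (ℕ.+-suc a b))))) ⟩
      gauss a (suc b) + x * gauss (suc a) b ∎
      where
      c = P (a ℕ.+ suc b)
      x = Q ^ suc a
      y = Q ^ suc b
      g = geometric x
      h = geometric y

    gauss-pascal′ : ∀ a b → gauss (suc a) (suc b) ≈ gauss (suc a) b + Q ^ suc b * gauss a (suc b)
    gauss-pascal′ a b = begin
      gauss (suc a) (suc b)                             ≈⟨ gauss-comm (suc a) (suc b) ⟩
      gauss (suc b) (suc a)                             ≈⟨ gauss-pascal b a ⟩
      gauss b (suc a) + Q ^ suc b * gauss (suc b) a     ≈⟨ +-cong (gauss-comm b (suc a)) (*-congˡ (gauss-comm (suc b) a)) ⟩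
      gauss (suc a) b + Q ^ suc b * gauss a (suc b)     ∎

    -- The Laurent term z^k Q^(k(k-1)/2). For k = -i the formal rule 1/z = w/Q turns it into w^i
    -- Q^(i(i-1)/2), the same shape with z and w exchanged.
    t : ℤ → Carrier
    t (+ i)    = z ^ i * Q ^ triangle i
    t -[1+ i ] = w ^ suc i * Q ^ triangle (suc i)

    t-neg : ∀ i → t (ℤ.- + i) ≈ w ^ i * Q ^ triangle i
    t-neg zero    = refl
    t-neg (suc i) = refl

    -- The recurrence t(k+1) = z Q^k t(k), multiplied by Q^b so that no negative power of Q remains
    -- when k < 0.
    t-suc : ∀ k n b → + b ℤ.+ k ≡ + n → z * Q ^ n * t k ≈ Q ^ b * t (ℤ.suc k)
    t-suc (+ i) _ b ≡.refl = begin
      z * Q ^ (b ℕ.+ i) * (z ^ i * Q ^ triangle i)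
        ≈⟨ *-congʳ (*-congˡ (^-homo-* Q b i)) ⟩
      z * (Q ^ b * Q ^ i) * (z ^ i * Q ^ triangle i)
        ≈⟨ solve 5 (λ z b i x t → z :* (b :* i) :* (x :* t) := b :* (z :* x :* (i :* t))) refl z _ _ _ _ ⟩
      Q ^ b * (z * z ^ i * (Q ^ i * Q ^ triangle i))
        ≈⟨ *-congˡ (*-congˡ (^-homo-* Q i (triangle i))) ⟨
      Q ^ b * t (+ suc i) ∎
    t-suc -[1+ i ] n b b-i≡n = begin
      z * Q ^ n * (w * w ^ i * Q ^ (i ℕ.+ triangle i))
        ≈⟨ *-congˡ (*-congˡ (^-homo-* Q i (triangle i))) ⟩
      z * Q ^ n * (w * w ^ i * (Q ^ i * Q ^ triangle i))
        ≈⟨ solve 6 (λ z n w x i t → z :* n :* (w :* x :* (i :* t)) := (z :* w) :* (n :* i) :* (x :* t)) refl z (Q ^ n) w (w ^ i) (Q ^ i) (Q ^ triangle i) ⟩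
      z * w * (Q ^ n * Q ^ i) * (w ^ i * Q ^ triangle i)
        ≈⟨ *-congʳ (*-cong zw≈Q (sym (^-homo-* Q n i))) ⟩
      Q ^ suc (n ℕ.+ i) * (w ^ i * Q ^ triangle i)
        ≈⟨ *-cong (^-congʳ Q b≡) (trans (sym (t-neg i)) (reflexive (≡.cong t (-i i)))) ⟩
      Q ^ b * t (ℤ.suc -[1+ i ]) ∎
      where
      open +-*-Solver using () renaming (solve to solveℤ; _:+_ to _⊕_; :-_ to ⊝_; _:=_ to _⊜_; con to conℤ)
      -i : ∀ i → ℤ.- + i ≡ ℤ.suc -[1+ i ]
      -i i = solveℤ 1 (λ i → ⊝ i ⊜ conℤ ℤ.1ℤ ⊕ (⊝ (conℤ ℤ.1ℤ ⊕ i))) ≡.refl (+ i)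
      b≡ : suc (n ℕ.+ i) ≡ b
      b≡ = ℤ.+-injective (≡.trans (≡.cong (λ m → ℤ.1ℤ ℤ.+ (m ℤ.+ + i)) (≡.sym b-i≡n))
        (solveℤ 2 (λ b i → conℤ ℤ.1ℤ ⊕ (b ⊕ (⊝ (conℤ ℤ.1ℤ ⊕ i)) ⊕ i) ⊜ b) ≡.refl (+ b) (+ i)))

    -- The q-binomial theorem, by the first Pascal rule. It is the case without z-factors from which
    -- the induction in `finite-triple-product` starts.
    binomial : ∀ p → ∏ p (λ k → 1# + w * Q ^ k) ≈ antidiagonal p (λ a b → gauss a b * (w ^ b * Q ^ triangle b))
    binomial zero    = sym (trans (*-cong (gauss-0ˡ 0) (*-identityʳ _)) (*-identityʳ _))
    binomial (suc p) = begin
      ∏ p (λ k → 1# + w * Q ^ k) * (1# + w * Q ^ p)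
        ≈⟨ trans (*-congʳ (binomial p)) (trans (distribˡ _ _ _) (+-comm _ _)) ⟩
      antidiagonal p F * (w * Q ^ p) + antidiagonal p F * 1#
        ≈⟨ +-cong (trans (antidiagonal-*ʳ p F _) (antidiagonal-cong p raise)) (*-identityʳ _) ⟩
      antidiagonal p (λ a b → Q ^ a * gauss a b * s (suc b)) + antidiagonal p F
        ≈⟨ antidiagonal-pascal p (λ a b → gauss a b * s b) _ _
             (λ b → *-congʳ (trans (gauss-0ˡ (suc b)) (sym (trans (*-identityˡ _) (gauss-0ˡ b)))))
             (λ a → *-congʳ (trans (gauss-0ʳ (suc a)) (sym (gauss-0ʳ a))))
             (λ a b → trans (*-congʳ (trans (gauss-pascal a b) (+-comm _ _))) (distribʳ _ _ _)) ⟨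
      antidiagonal (suc p) (λ a b → gauss a b * s b) ∎
      where
      s : ℕ → Carrier
      s b = w ^ b * Q ^ triangle b
      F : ℕ → ℕ → Carrier
      F a b = gauss a b * s b
      raise : ∀ a b → a ℕ.+ b ≡ p → gauss a b * s b * (w * Q ^ p) ≈ Q ^ a * gauss a b * s (suc b)
      raise a b ≡.refl = begin
        gauss a b * (w ^ b * Q ^ triangle b) * (w * Q ^ (a ℕ.+ b))
          ≈⟨ *-congˡ (*-congˡ (^-homo-* Q a b)) ⟩
        gauss a b * (w ^ b * Q ^ triangle b) * (w * (Q ^ a * Q ^ b))
          ≈⟨ solve 6 (λ g x t w a b → g :* (x :* t) :* (w :* (a :* b)) := a :* g :* (w :* x :* (b :* t))) refl _ _ _ _ _ _ ⟩
        Q ^ a * gauss a b * (w * w ^ b * (Q ^ b * Q ^ triangle b))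
          ≈⟨ *-congˡ (*-congˡ (^-homo-* Q b (triangle b))) ⟨
        Q ^ a * gauss a b * s (suc b) ∎

    -- A new factor 1 + z Q^n either keeps the index k = a - p or raises it by one. In the second
    -- case b + k = n, so `t-suc` leaves exactly the weight Q^b that the second Pascal rule asks
    -- for.
    finite-triple-product : ∀ p n → ∏ p (λ k → 1# + w * Q ^ k) * ∏ n (λ k → 1# + z * Q ^ k)
      ≈ antidiagonal (p ℕ.+ n) (λ a b → gauss a b * t (+ a ℤ.- + p))
    finite-triple-product p zero rewrite ℕ.+-identityʳ p =
      trans (*-identityʳ _) (trans (binomial p) (antidiagonal-cong p λ a b a+b≡p →
        *-congˡ (trans (sym (t-neg b)) (reflexive (≡.cong t (index a b a+b≡p))))))
      where
      open +-*-Solver using () renaming (solve to solveℤ; _:+_ to _⊕_; :-_ to ⊝_; _:=_ to _⊜_; con to conℤ)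
      index : ∀ a b → a ℕ.+ b ≡ p → ℤ.- + b ≡ + a ℤ.- + p
      index a b ≡.refl = solveℤ 2 (λ a b → ⊝ b ⊜ a ⊕ (⊝ (a ⊕ b))) ≡.refl (+ a) (+ b)
    finite-triple-product p (suc n) rewrite ℕ.+-suc p n = begin
      ∏ p (λ k → 1# + w * Q ^ k) * (∏ n (λ k → 1# + z * Q ^ k) * (1# + z * Q ^ n))
        ≈⟨ *-assoc _ _ _ ⟨
      ∏ p (λ k → 1# + w * Q ^ k) * ∏ n (λ k → 1# + z * Q ^ k) * (1# + z * Q ^ n)
        ≈⟨ trans (*-congʳ (finite-triple-product p n)) (distribˡ _ _ _) ⟩
      antidiagonal (p ℕ.+ n) F * 1# + antidiagonal (p ℕ.+ n) F * (z * Q ^ n)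
        ≈⟨ +-cong (*-identityʳ _) (trans (antidiagonal-*ʳ (p ℕ.+ n) F _) (antidiagonal-cong (p ℕ.+ n) raise)) ⟩
      antidiagonal (p ℕ.+ n) F + antidiagonal (p ℕ.+ n) (λ a b → Q ^ b * gauss a b * t (+ suc a ℤ.- + p))
        ≈⟨ antidiagonal-pascal (p ℕ.+ n) (λ a b → gauss a b * t (+ a ℤ.- + p)) _ _
             (λ b → *-congʳ (trans (gauss-0ˡ (suc b)) (sym (gauss-0ˡ b))))
             (λ a → *-congʳ (trans (gauss-0ʳ (suc a)) (sym (trans (*-identityˡ _) (gauss-0ʳ a)))))
             (λ a b → trans (*-congʳ (gauss-pascal′ a b)) (distribʳ _ _ _)) ⟨
      antidiagonal (suc (p ℕ.+ n)) (λ a b → gauss a b * t (+ a ℤ.- + p)) ∎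
      where
      open +-*-Solver using () renaming (solve to solveℤ; _:+_ to _⊕_; :-_ to ⊝_; _:=_ to _⊜_; con to conℤ)
      F : ℕ → ℕ → Carrier
      F a b = gauss a b * t (+ a ℤ.- + p)
      raise : ∀ a b → a ℕ.+ b ≡ p ℕ.+ n → F a b * (z * Q ^ n) ≈ Q ^ b * gauss a b * t (+ suc a ℤ.- + p)
      raise a b a+b≡p+n = begin
        gauss a b * t (+ a ℤ.- + p) * (z * Q ^ n)
          ≈⟨ solve 3 (λ g t x → g :* t :* x := g :* (x :* t)) refl _ _ _ ⟩
        gauss a b * (z * Q ^ n * t (+ a ℤ.- + p))
          ≈⟨ *-congˡ (t-suc (+ a ℤ.- + p) n b exponent) ⟩
        gauss a b * (Q ^ b * t (ℤ.suc (+ a ℤ.- + p)))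
          ≈⟨ solve 3 (λ g x t → g :* (x :* t) := x :* g :* t) refl _ _ _ ⟩
        Q ^ b * gauss a b * t (ℤ.suc (+ a ℤ.- + p))
          ≈⟨ *-congˡ (reflexive (≡.cong t (≡.sym (ℤ.+-assoc ℤ.1ℤ (+ a) (ℤ.- + p))))) ⟩
        Q ^ b * gauss a b * t (+ suc a ℤ.- + p) ∎
        where
        exponent : + b ℤ.+ (+ a ℤ.- + p) ≡ + n
        exponent = ≡.trans (solveℤ 3 (λ a b p → b ⊕ (a ⊕ (⊝ p)) ⊜ (a ⊕ b) ⊕ (⊝ p)) ≡.refl (+ a) (+ b) (+ p))
          (≡.trans (≡.cong (λ m → + m ℤ.- + p) a+b≡p+n)
            (solveℤ 2 (λ p n → p ⊕ n ⊕ (⊝ p) ⊜ n) ≡.refl (+ p) (+ n)))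

    -- Terms with N ≤ ∣k∣ vanish. For the others M ≥ 2N forces a ≥ N and b ≥ N, where `P` and `I`
    -- have already become stationary, so the Gaussian binomial times `P M` is 1.
    triple-product : ∀ {M} → N ℕ.+ N ≤ M → VanishesFrom N t →
      ∏ M (λ k → 1# + w * Q ^ k) * ∏ M (λ k → 1# + z * Q ^ k) * P M ≈ box M t
    triple-product {M} 2N≤M t≈0 = begin
      ∏ M (λ k → 1# + w * Q ^ k) * ∏ M (λ k → 1# + z * Q ^ k) * P M
        ≈⟨ *-congʳ (finite-triple-product M M) ⟩
      antidiagonal (M ℕ.+ M) (λ a b → gauss a b * t (+ a ℤ.- + M)) * P M
        ≈⟨ antidiagonal-*ʳ (M ℕ.+ M) _ _ ⟩
      antidiagonal (M ℕ.+ M) (λ a b → gauss a b * t (+ a ℤ.- + M) * P M)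
        ≈⟨ antidiagonal-cong (M ℕ.+ M) coefficient ⟩
      antidiagonal (M ℕ.+ M) (λ a _ → t (+ a ℤ.- + M))
        ≈⟨ antidiagonal-big (M ℕ.+ M) _ ⟩
      box M t + t (+ (M ℕ.+ M) ℤ.- + M)
        -- The antidiagonal includes the index k = M, which the half-open box omits.
        ≈⟨ trans (+-congˡ (t≈0 (+ (M ℕ.+ M) ℤ.- + M) (≡.subst (N ≤_) (≡.sym (≡.cong ∣_∣ (top (+ M)))) N≤M))) (+-identityʳ _) ⟩
      box M t ∎
      where
      open +-*-Solver using () renaming (solve to solveℤ; _:+_ to _⊕_; :-_ to ⊝_; _:=_ to _⊜_; con to conℤ)
      N≤M = ℕ.≤-trans (ℕ.m≤m+n N N) 2N≤M
      top : ∀ m → m ℤ.+ m ℤ.- m ≡ m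
      top = solveℤ 1 (λ m → m ⊕ m ⊕ (⊝ m) ⊜ m) ≡.refl
      far : ∀ c → ∣ + c ℤ.- + M ∣ < N → N ≤ c
      far c ∣c-M∣<N = ℕ.+-cancelˡ-≤ N N c (ℕ.≤-trans 2N≤M (ℕ.≤-trans
        (≡.subst (λ k → M ≤ ∣ k ∣ ℕ.+ c) (solveℤ 2 (λ m c → m ⊕ (⊝ c) ⊜ ⊝ (c ⊕ (⊝ m))) ≡.refl (+ M) (+ c))
          (ℕ.≤-trans (∣i∣≤∣i+j∣+∣j∣ (+ M) (ℤ.- + c)) (ℕ.+-monoʳ-≤ _ (ℕ.≤-reflexive (ℤ.∣-i∣≡∣i∣ (+ c))))))
        (ℕ.+-monoˡ-≤ c (≡.subst (_≤ N) (≡.sym (ℤ.∣-i∣≡∣i∣ (+ c ℤ.- + M))) (ℕ.<⇒≤ ∣c-M∣<N)))))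
      coefficient : ∀ a b → a ℕ.+ b ≡ M ℕ.+ M → gauss a b * t (+ a ℤ.- + M) * P M ≈ t (+ a ℤ.- + M)
      coefficient a b a+b≡2M with ℕ.≤-<-connex N ∣ + a ℤ.- + M ∣
      ... | inj₁ N≤∣k∣ = trans (*-congʳ (trans (*-congˡ t≈0′) (zeroʳ _))) (trans (zeroˡ _) (sym t≈0′))
        where t≈0′ = t≈0 (+ a ℤ.- + M) N≤∣k∣
      ... | inj₂ ∣k∣<N = begin
        P (a ℕ.+ b) * (I a * I b) * t′ * P M
          ≈⟨ *-cong (*-congʳ (*-cong (P-stable (ℕ.≤-trans N≤a (ℕ.m≤m+n a b))) (*-cong (I-stable N≤a) (I-stable N≤b)))) (P-stable N≤M) ⟩
        P N * (I N * I N) * t′ * P N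
          ≈⟨ solve 3 (λ p i t → p :* (i :* i) :* t :* p := (p :* i) :* (p :* i) :* t) refl (P N) (I N) t′ ⟩
        P N * I N * (P N * I N) * t′
          ≈⟨ *-congʳ (trans (*-cong (P*I N) (P*I N)) (*-identityˡ _)) ⟩
        1# * t′
          ≈⟨ *-identityˡ _ ⟩
        t′ ∎
        where
        t′ = t (+ a ℤ.- + M)
        N≤a = far a ∣k∣<N
        mirror : ∣ + b ℤ.- + M ∣ ≡ ∣ + a ℤ.- + M ∣
        mirror = ≡.trans (≡.cong ∣_∣ (≡.trans
            (solveℤ 3 (λ a b m → b ⊕ (⊝ m) ⊜ ⊝ (a ⊕ (⊝ (a ⊕ b ⊕ (⊝ m))))) ≡.refl (+ a) (+ b) (+ M))
            (≡.cong (λ k → ℤ.- (+ a ℤ.- k)) (≡.trans (≡.cong (λ m → + m ℤ.- + M) a+b≡2M) (top (+ M))))))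
          (ℤ.∣-i∣≡∣i∣ (+ a ℤ.- + M))
        N≤b = far b (≡.subst (_< N) (≡.sym mirror) ∣k∣<N)

-- Theta functions

-- (c + d) k² / 2 + (c − d) k / 2, the exponent of the k-th term of Ramanujan's f(q^c, q^d).
exponent : ℕ → ℕ → ℤ → ℕ
exponent c d (+ i)    = c ℕ.* i ℕ.+ (c ℕ.+ d) ℕ.* triangle i
exponent c d -[1+ i ] = d ℕ.* suc i ℕ.+ (c ℕ.+ d) ℕ.* triangle (suc i)

module _ where
  open +-*-Solver
  open ≡.≡-Reasoning

  double-triangle : ∀ i → + triangle i ℤ.+ + triangle i ≡ + i ℤ.* + i ℤ.- + i
  double-triangle zero    = ≡.refl
  double-triangle (suc i) = begin
    + i ℤ.+ + triangle i ℤ.+ (+ i ℤ.+ + triangle i)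
      ≡⟨ solve 2 (λ i t → i :+ t :+ (i :+ t) := i :+ i :+ (t :+ t)) ≡.refl (+ i) (+ triangle i) ⟩
    + i ℤ.+ + i ℤ.+ (+ triangle i ℤ.+ + triangle i)
      ≡⟨ ≡.cong (ℤ._+_ (+ i ℤ.+ + i)) (double-triangle i) ⟩
    + i ℤ.+ + i ℤ.+ (+ i ℤ.* + i ℤ.- + i)
      ≡⟨ solve 1 (λ i → i :+ i :+ (i :* i :- i) := (con ℤ.1ℤ :+ i) :* (con ℤ.1ℤ :+ i) :- (con ℤ.1ℤ :+ i)) ≡.refl (+ i) ⟩
    + suc i ℤ.* + suc i ℤ.- + suc i ∎

  quadratic : ℕ → ℕ → ℤ → ℤ
  quadratic c d k = (+ c ℤ.+ + d) ℤ.* (k ℤ.* k) ℤ.+ (+ c ℤ.- + d) ℤ.* k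

  -- Doubling removes the triangular numbers and the distinction of signs of k, so that identities
  -- between exponents become polynomial identities over ℤ.
  double-exponent : ∀ c d k → + exponent c d k ℤ.+ + exponent c d k ≡ quadratic c d k
  double-exponent c d (+ i) = begin
    + (c ℕ.* i ℕ.+ (c ℕ.+ d) ℕ.* T) ℤ.+ + (c ℕ.* i ℕ.+ (c ℕ.+ d) ℕ.* T)
      ≡⟨ ≡.cong (λ x → x ℤ.+ x) (≡.cong₂ ℤ._+_ (ℤ.pos-* c i) (ℤ.pos-* (c ℕ.+ d) T)) ⟩
    + c ℤ.* + i ℤ.+ (+ c ℤ.+ + d) ℤ.* + T ℤ.+ (+ c ℤ.* + i ℤ.+ (+ c ℤ.+ + d) ℤ.* + T)
      ≡⟨ solve 4 (λ c d i T → c :* i :+ (c :+ d) :* T :+ (c :* i :+ (c :+ d) :* T) := c :* i :+ c :* i :+ (c :+ d) :* (T :+ T)) ≡.refl (+ c) (+ d) (+ i) (+ T) ⟩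
    + c ℤ.* + i ℤ.+ + c ℤ.* + i ℤ.+ (+ c ℤ.+ + d) ℤ.* (+ T ℤ.+ + T)
      ≡⟨ ≡.cong (λ x → + c ℤ.* + i ℤ.+ + c ℤ.* + i ℤ.+ (+ c ℤ.+ + d) ℤ.* x) (double-triangle i) ⟩
    + c ℤ.* + i ℤ.+ + c ℤ.* + i ℤ.+ (+ c ℤ.+ + d) ℤ.* (+ i ℤ.* + i ℤ.- + i)
      ≡⟨ solve 3 (λ c d i → c :* i :+ c :* i :+ (c :+ d) :* (i :* i :- i) := (c :+ d) :* (i :* i) :+ (c :- d) :* i) ≡.refl (+ c) (+ d) (+ i) ⟩
    quadratic c d (+ i) ∎
    where T = triangle i
  double-exponent c d -[1+ i ] = begin
    + exponent c d -[1+ i ] ℤ.+ + exponent c d -[1+ i ]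
      ≡⟨ ≡.cong (λ n → + n ℤ.+ + n) (≡.cong (λ s → d ℕ.* suc i ℕ.+ s ℕ.* triangle (suc i)) (ℕ.+-comm c d)) ⟩
    + exponent d c (+ suc i) ℤ.+ + exponent d c (+ suc i)
      ≡⟨ double-exponent d c (+ suc i) ⟩
    quadratic d c (+ suc i)
      ≡⟨ solve 3 (λ c d k → (d :+ c) :* (k :* k) :+ (d :- c) :* k := (c :+ d) :* ((:- k) :* (:- k)) :+ (c :- d) :* (:- k)) ≡.refl (+ c) (+ d) (+ suc i) ⟩
    quadratic c d -[1+ i ] ∎

  double-injective : ∀ {m n} → + m ℤ.+ + m ≡ + n ℤ.+ + n → m ≡ n
  double-injective {m} {n} eq = ℕ.*-cancelˡ-≡ m n 2
    (≡.trans (≡.cong (m ℕ.+_) (ℕ.+-identityʳ m)) (≡.trans (ℤ.+-injective eq) (≡.sym (≡.cong (n ℕ.+_) (ℕ.+-identityʳ n)))))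

  -- For f(α, β) f(γ, δ) with αβ = γδ, put α = q^a, β/δ = q^e and β/γ = q^r; all exponents in the
  -- product formula are then sums. The right-hand side belongs to f(αγ, βδ) in k and f(αδ, βγ) in
  -- l: the substitution diagonalises the quadratic form.
  exponents-even : ∀ a e r k l →
    exponent a (a ℕ.+ e ℕ.+ r) (k ℤ.- l) ℕ.+ exponent (a ℕ.+ e) (a ℕ.+ r) (k ℤ.+ l)
      ≡ exponent (a ℕ.+ a ℕ.+ e) (a ℕ.+ a ℕ.+ e ℕ.+ (r ℕ.+ r)) k ℕ.+ exponent (a ℕ.+ a ℕ.+ (e ℕ.+ e) ℕ.+ r) (a ℕ.+ a ℕ.+ r) l
  exponents-even a e r k l = double-injective (begin
    x ℤ.+ y ℤ.+ (x ℤ.+ y)         ≡⟨ interchange x y x y ⟩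
    x ℤ.+ x ℤ.+ (y ℤ.+ y)         ≡⟨ ≡.cong₂ ℤ._+_ (double-exponent a (a ℕ.+ e ℕ.+ r) (k ℤ.- l)) (double-exponent (a ℕ.+ e) (a ℕ.+ r) (k ℤ.+ l)) ⟩
    _                             ≡⟨ solve 5 (λ a e r k l →
      let q = λ c d k → (c :+ d) :* (k :* k) :+ (c :- d) :* k in
      q a (a :+ e :+ r) (k :- l) :+ q (a :+ e) (a :+ r) (k :+ l)
        := q (a :+ a :+ e) (a :+ a :+ e :+ (r :+ r)) k :+ q (a :+ a :+ (e :+ e) :+ r) (a :+ a :+ r) l) ≡.refl (+ a) (+ e) (+ r) k l ⟩
    _                             ≡⟨ ≡.cong₂ ℤ._+_ (double-exponent (a ℕ.+ a ℕ.+ e) _ k) (double-exponent (a ℕ.+ a ℕ.+ (e ℕ.+ e) ℕ.+ r) _ l) ⟨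
    z ℤ.+ z ℤ.+ (w ℤ.+ w)         ≡⟨ interchange z z w w ⟩
    z ℤ.+ w ℤ.+ (z ℤ.+ w)         ∎)
    where
    x = + exponent a (a ℕ.+ e ℕ.+ r) (k ℤ.- l)
    y = + exponent (a ℕ.+ e) (a ℕ.+ r) (k ℤ.+ l)
    z = + exponent (a ℕ.+ a ℕ.+ e) (a ℕ.+ a ℕ.+ e ℕ.+ (r ℕ.+ r)) k
    w = + exponent (a ℕ.+ a ℕ.+ (e ℕ.+ e) ℕ.+ r) (a ℕ.+ a ℕ.+ r) l
    open CommutativeSemigroupProperties ℤ.+-commutativeSemigroup using (interchange)

  -- Completing the square for odd n - m leaves the prefactor α = q^a, and the l-variable comes out
  -- shifted by one.
  exponents-odd : ∀ a e r k l →
    exponent a (a ℕ.+ e ℕ.+ r) (k ℤ.- l) ℕ.+ exponent (a ℕ.+ e) (a ℕ.+ r) (k ℤ.+ l ℤ.+ ℤ.1ℤ)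
      ≡ a ℕ.+ (exponent (a ℕ.+ a ℕ.+ (a ℕ.+ a) ℕ.+ (e ℕ.+ e) ℕ.+ r) r k ℕ.+ exponent e (a ℕ.+ a ℕ.+ (a ℕ.+ a) ℕ.+ e ℕ.+ (r ℕ.+ r)) (l ℤ.+ ℤ.1ℤ))
  exponents-odd a e r k l = double-injective (begin
    x ℤ.+ y ℤ.+ (x ℤ.+ y)         ≡⟨ interchange x y x y ⟩
    x ℤ.+ x ℤ.+ (y ℤ.+ y)         ≡⟨ ≡.cong₂ ℤ._+_ (double-exponent a (a ℕ.+ e ℕ.+ r) (k ℤ.- l)) (double-exponent (a ℕ.+ e) (a ℕ.+ r) (k ℤ.+ l ℤ.+ ℤ.1ℤ)) ⟩
    _                             ≡⟨ solve 5 (λ a e r k l →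
      let q = λ c d k → (c :+ d) :* (k :* k) :+ (c :- d) :* k in
      q a (a :+ e :+ r) (k :- l) :+ q (a :+ e) (a :+ r) (k :+ l :+ con ℤ.1ℤ)
        := a :+ a :+ (q (a :+ a :+ (a :+ a) :+ (e :+ e) :+ r) r k :+ q e (a :+ a :+ (a :+ a) :+ e :+ (r :+ r)) (l :+ con ℤ.1ℤ))) ≡.refl (+ a) (+ e) (+ r) k l ⟩
    _                             ≡⟨ ≡.cong (ℤ._+_ (+ a ℤ.+ + a)) (≡.cong₂ ℤ._+_ (double-exponent (a ℕ.+ a ℕ.+ (a ℕ.+ a) ℕ.+ (e ℕ.+ e) ℕ.+ r) r k) (double-exponent e _ (l ℤ.+ ℤ.1ℤ))) ⟨
    + a ℤ.+ + a ℤ.+ (z ℤ.+ z ℤ.+ (w ℤ.+ w))         ≡⟨ solve 3 (λ a z w → a :+ a :+ (z :+ z :+ (w :+ w)) := a :+ (z :+ w) :+ (a :+ (z :+ w))) ≡.refl (+ a) z w ⟩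
    + a ℤ.+ (z ℤ.+ w) ℤ.+ (+ a ℤ.+ (z ℤ.+ w))       ∎)
    where
    x = + exponent a (a ℕ.+ e ℕ.+ r) (k ℤ.- l)
    y = + exponent (a ℕ.+ e) (a ℕ.+ r) (k ℤ.+ l ℤ.+ ℤ.1ℤ)
    z = + exponent (a ℕ.+ a ℕ.+ (a ℕ.+ a) ℕ.+ (e ℕ.+ e) ℕ.+ r) r k
    w = + exponent e (a ℕ.+ a ℕ.+ (a ℕ.+ a) ℕ.+ e ℕ.+ (r ℕ.+ r)) (l ℤ.+ ℤ.1ℤ)
    open CommutativeSemigroupProperties ℤ.+-commutativeSemigroup using (interchange)

exponent-bound : ∀ {c d} → 1 ≤ c → 1 ≤ d → ∀ k → ∣ k ∣ ≤ exponent c d k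
exponent-bound {c} 1≤c 1≤d (+ i) =
  ℕ.≤-trans (≡.subst (_≤ c ℕ.* i) (ℕ.*-identityˡ i) (ℕ.*-monoˡ-≤ i 1≤c)) (ℕ.m≤m+n _ _)
exponent-bound {d = d} 1≤c 1≤d -[1+ i ] =
  ℕ.≤-trans (≡.subst (_≤ d ℕ.* suc i) (ℕ.*-identityˡ (suc i)) (ℕ.*-monoˡ-≤ (suc i) 1≤d)) (ℕ.m≤m+n _ _)

module Theta (R : CommutativeSemiring 0ℓ 0ℓ) (ν : CommutativeSemiring.Carrier R) (1+ν≈0 : IsMinusOne R ν)
  (N : ℕ) (q : CommutativeSemiring.Carrier R) (q^N≈0 : IsNilpotent R N q) where
  open CommutativeSemiring R
  open Exponent R
  open Nilpotent R ν 1+ν≈0 N public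
  open IntegerSum +-commutativeMonoid
  open SetoidReasoning setoid
  open NaturalSolver R using (solve; _:=_; _:+_; _:*_; con)

  -- Only signs with σ² = 1 are of interest, and for them σ^∣k∣ is the same as σ^k for negative k
  -- too.
  term : Carrier → ℕ → ℕ → ℤ → Carrier
  term σ c d k = σ ^ ∣ k ∣ * q ^ exponent c d k

  θ : Carrier → ℕ → ℕ → Carrier
  θ σ c d = box N (term σ c d)

  term-vanishes : ∀ σ {c d} → 1 ≤ c → 1 ≤ d → VanishesFrom N (term σ c d)
  term-vanishes σ 1≤c 1≤d k N≤∣k∣ =
    trans (*-congˡ (nil-≥ q^N≈0 (ℕ.≤-trans N≤∣k∣ (exponent-bound 1≤c 1≤d k)))) (zeroʳ _)

  θ-box : ∀ σ {c d A} → 1 ≤ c → 1 ≤ d → N ≤ A → θ σ c d ≈ box A (term σ c d)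
  θ-box σ 1≤c 1≤d N≤A = sym (box-extend (term-vanishes σ 1≤c 1≤d) N≤A)

  -- Jacobi's identity at z = σ q^c, w = σ q^d, where σ² = 1 gives z w = q^(c+d). The number M of
  -- factors stays free, so that later exactly 2N factors can be split by parity.
  θ-product : ∀ {σ c d M} → σ * σ ≈ 1# → 1 ≤ c → 1 ≤ d → N ℕ.+ N ≤ M →
    θ σ c d ≈ ∏ M (λ k → 1# + σ * q ^ d * (q ^ (c ℕ.+ d)) ^ k) * ∏ M (λ k → 1# + σ * q ^ c * (q ^ (c ℕ.+ d)) ^ k)
              * ∏ M (λ k → 1# + ν * (q ^ (c ℕ.+ d)) ^ suc k)
  θ-product {σ} {c} {d} {M} σ²≈1 1≤c 1≤d 2N≤M = begin
    θ σ c d                 ≈⟨ θ-box σ 1≤c 1≤d (ℕ.≤-trans (ℕ.m≤m+n N N) 2N≤M) ⟩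
    box M (term σ c d)      ≈⟨ box-cong M (λ k _ → t≈term k) ⟨
    box M t                 ≈⟨ triple-product 2N≤M (λ k N≤k → trans (t≈term k) (term-vanishes σ 1≤c 1≤d k N≤k)) ⟨
    _                       ∎
    where
    zw≈Q : σ * q ^ c * (σ * q ^ d) ≈ q ^ (c ℕ.+ d)
    zw≈Q = begin
      σ * q ^ c * (σ * q ^ d)     ≈⟨ solve 3 (λ s x y → s :* x :* (s :* y) := s :* s :* (x :* y)) refl σ _ _ ⟩
      σ * σ * (q ^ c * q ^ d)     ≈⟨ *-cong σ²≈1 (sym (^-homo-* q c d)) ⟩
      1# * q ^ (c ℕ.+ d)          ≈⟨ *-identityˡ _ ⟩
      q ^ (c ℕ.+ d)               ∎
    Q-nil : ∀ n → 1 ≤ n → Nil (q ^ n)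
    Q-nil (suc n) _ = nil-^ n q^N≈0
    open JacobiTripleProduct (σ * q ^ c) (σ * q ^ d) (q ^ (c ℕ.+ d)) zw≈Q (Q-nil (c ℕ.+ d) (ℕ.≤-trans 1≤c (ℕ.m≤m+n c d)))
    power : ∀ e i → (σ * q ^ e) ^ i * (q ^ (c ℕ.+ d)) ^ triangle i ≈ σ ^ i * q ^ (e ℕ.* i ℕ.+ (c ℕ.+ d) ℕ.* triangle i)
    power e i = begin
      (σ * q ^ e) ^ i * (q ^ (c ℕ.+ d)) ^ triangle i
        ≈⟨ *-cong (trans (^-distrib-* σ (q ^ e) i) (*-congˡ (^-assocʳ q e i))) (^-assocʳ q (c ℕ.+ d) (triangle i)) ⟩
      σ ^ i * q ^ (e ℕ.* i) * q ^ ((c ℕ.+ d) ℕ.* triangle i)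
        ≈⟨ *-assoc _ _ _ ⟩
      σ ^ i * (q ^ (e ℕ.* i) * q ^ ((c ℕ.+ d) ℕ.* triangle i))
        ≈⟨ *-congˡ (^-homo-* q (e ℕ.* i) _) ⟨
      σ ^ i * q ^ (e ℕ.* i ℕ.+ (c ℕ.+ d) ℕ.* triangle i) ∎
    t≈term : ∀ k → t k ≈ term σ c d k
    t≈term (+ i)    = power c i
    t≈term -[1+ i ] = power d (suc i)

  1^ : ∀ n → 1# ^ n ≈ 1#
  1^ zero    = refl
  1^ (suc n) = trans (*-identityˡ _) (1^ n)

  module _ {σ} (σ²≈1 : σ * σ ≈ 1#) where

    sign-square : ∀ n → σ ^ n * σ ^ n ≈ 1#
    sign-square n = trans (sym (^-distrib-* σ σ n)) (trans (^-congˡ n σ²≈1) (1^ n))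

    sign-suc : ∀ k → σ ^ ∣ k ℤ.+ ℤ.1ℤ ∣ ≈ σ * σ ^ ∣ k ∣
    sign-suc (+ i)          = ^-congʳ σ (ℕ.+-comm i 1)
    sign-suc -[1+ zero ]    = sym (trans (*-congˡ (*-identityʳ σ)) σ²≈1)
    sign-suc -[1+ suc i ]   = sym (trans (sym (*-assoc _ _ _)) (trans (*-congʳ σ²≈1) (*-identityˡ _)))

    sign-+ : ∀ k n → σ ^ ∣ k ℤ.+ + n ∣ ≈ σ ^ n * σ ^ ∣ k ∣
    sign-+ k zero    = trans (reflexive (≡.cong (λ k → σ ^ ∣ k ∣) (ℤ.+-identityʳ k))) (sym (*-identityˡ _))
    sign-+ k (suc n) = begin
      σ ^ ∣ k ℤ.+ + suc n ∣             ≡⟨ ≡.cong (λ k → σ ^ ∣ k ∣) (solveℤ 2 (λ k n → k ⊕ (conℤ ℤ.1ℤ ⊕ n) ⊜ k ⊕ n ⊕ conℤ ℤ.1ℤ) ≡.refl k (+ n)) ⟩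
      σ ^ ∣ k ℤ.+ + n ℤ.+ ℤ.1ℤ ∣        ≈⟨ sign-suc (k ℤ.+ + n) ⟩
      σ * σ ^ ∣ k ℤ.+ + n ∣             ≈⟨ *-congˡ (sign-+ k n) ⟩
      σ * (σ ^ n * σ ^ ∣ k ∣)           ≈⟨ *-assoc _ _ _ ⟨
      σ ^ suc n * σ ^ ∣ k ∣             ∎
      where open +-*-Solver using () renaming (solve to solveℤ; _:+_ to _⊕_; _:=_ to _⊜_; con to conℤ)

    sign-double : ∀ k l → σ ^ ∣ k ℤ.+ (l ℤ.+ l) ∣ ≈ σ ^ ∣ k ∣
    sign-double k (+ n)    = begin
      σ ^ ∣ k ℤ.+ + (n ℕ.+ n) ∣         ≈⟨ sign-+ k (n ℕ.+ n) ⟩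
      σ ^ (n ℕ.+ n) * σ ^ ∣ k ∣         ≈⟨ *-congʳ (trans (^-homo-* σ n n) (sign-square n)) ⟩
      1# * σ ^ ∣ k ∣                    ≈⟨ *-identityˡ _ ⟩
      σ ^ ∣ k ∣                         ∎
    sign-double k -[1+ n ] = begin
      σ ^ ∣ k ℤ.+ (l ℤ.+ l) ∣                              ≈⟨ sign-double (k ℤ.+ (l ℤ.+ l)) (+ suc n) ⟨
      σ ^ ∣ k ℤ.+ (l ℤ.+ l) ℤ.+ (+ suc n ℤ.+ + suc n) ∣    ≡⟨ ≡.cong (λ k → σ ^ ∣ k ∣) (solveℤ 2 (λ k n → k ⊕ (⊝ n ⊕ ⊝ n) ⊕ (n ⊕ n) ⊜ k) ≡.refl k (+ suc n)) ⟩
      σ ^ ∣ k ∣                                            ∎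
      where
      l = -[1+ n ]
      open +-*-Solver using () renaming (solve to solveℤ; _:+_ to _⊕_; :-_ to ⊝_; _:=_ to _⊜_; con to conℤ)

    -- k + l and k - l have the same parity. Hence the theta functions on the right of the product
    -- formula carry no sign, and by `sign-odd` a single σ is left in front of the odd part.
    sign-even : ∀ k l → σ ^ ∣ k ℤ.- l ∣ * σ ^ ∣ k ℤ.+ l ∣ ≈ 1#
    sign-even k l = trans (*-congˡ (trans (reflexive (≡.cong (λ k → σ ^ ∣ k ∣) index)) (sign-double (k ℤ.- l) l)))
                          (sign-square ∣ k ℤ.- l ∣)
      where
      open +-*-Solver using () renaming (solve to solveℤ; _:+_ to _⊕_; _:-_ to _⊖′_; _:=_ to _⊜_)
      index : k ℤ.+ l ≡ k ℤ.- l ℤ.+ (l ℤ.+ l)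
      index = solveℤ 2 (λ k l → k ⊕ l ⊜ k ⊖′ l ⊕ (l ⊕ l)) ≡.refl k l

    sign-odd : ∀ k l → σ ^ ∣ k ℤ.- l ∣ * σ ^ ∣ k ℤ.+ l ℤ.+ ℤ.1ℤ ∣ ≈ σ
    sign-odd k l = begin
      σ ^ ∣ k ℤ.- l ∣ * σ ^ ∣ k ℤ.+ l ℤ.+ ℤ.1ℤ ∣      ≈⟨ *-congˡ (sign-suc (k ℤ.+ l)) ⟩
      σ ^ ∣ k ℤ.- l ∣ * (σ * σ ^ ∣ k ℤ.+ l ∣)          ≈⟨ solve 3 (λ x s y → x :* (s :* y) := s :* (x :* y)) refl (σ ^ ∣ k ℤ.- l ∣) σ (σ ^ ∣ k ℤ.+ l ∣) ⟩
      σ * (σ ^ ∣ k ℤ.- l ∣ * σ ^ ∣ k ℤ.+ l ∣)          ≈⟨ trans (*-congˡ (sign-even k l)) (*-identityʳ σ) ⟩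
      σ                                                ∎

  ∑-*ʳ : ∀ n f x → ∑ n f * x ≈ ∑ n (λ i → f i * x)
  ∑-*ʳ zero    f x = zeroˡ x
  ∑-*ʳ (suc n) f x = trans (distribʳ x _ _) (+-congʳ (∑-*ʳ n f x))

  ∑-*ˡ : ∀ n x f → x * ∑ n f ≈ ∑ n (λ i → x * f i)
  ∑-*ˡ n x f = trans (*-comm _ _) (trans (∑-*ʳ n f x) (Sum.big-cong′ n (λ i → *-comm _ _)))

  box-*ˡ : ∀ A x f → x * box A f ≈ box A (λ k → x * f k)
  box-*ˡ A x f = ∑-*ˡ (A ℕ.+ A) x _

  box-* : ∀ A B f g → box A f * box B g ≈ box A (λ k → box B (λ l → f k * g l))
  box-* A B f g = trans (∑-*ʳ (A ℕ.+ A) _ _) (box-cong A (λ k _ → box-*ˡ B (f k) g))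

  -- Ramanujan's product formula for f(α, β) f(γ, δ) with αβ = γδ.
  θ-multiplication : ∀ {σ} a e r → σ * σ ≈ 1# → 1 ≤ a → 1 ≤ e → 1 ≤ r →
    θ σ a (a ℕ.+ e ℕ.+ r) * θ σ (a ℕ.+ e) (a ℕ.+ r)
      ≈ θ 1# (a ℕ.+ a ℕ.+ e) (a ℕ.+ a ℕ.+ e ℕ.+ (r ℕ.+ r)) * θ 1# (a ℕ.+ a ℕ.+ (e ℕ.+ e) ℕ.+ r) (a ℕ.+ a ℕ.+ r)
      + σ * q ^ a * (θ 1# (a ℕ.+ a ℕ.+ (a ℕ.+ a) ℕ.+ (e ℕ.+ e) ℕ.+ r) r * θ 1# e (a ℕ.+ a ℕ.+ (a ℕ.+ a) ℕ.+ e ℕ.+ (r ℕ.+ r)))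
  θ-multiplication {σ} a e r σ²≈1 1≤a 1≤e 1≤r = begin
    θ σ a (a ℕ.+ e ℕ.+ r) * θ σ (a ℕ.+ e) (a ℕ.+ r)
      ≈⟨ *-cong (θ-box σ 1≤a (a≤ (a≤ 1≤a)) N≤B) (θ-box σ (a≤ 1≤a) (a≤ 1≤a) N≤2A) ⟩
    box B f * box (A ℕ.+ A) g
      ≈⟨ box-* B (A ℕ.+ A) f g ⟩
    box B (λ m → box (A ℕ.+ A) (λ n → f m * g n))
      ≈⟨ box-rotate outside ⟩
    box A (λ l → box B (λ k → f (k ℤ.- l) * g (k ℤ.+ l))) + box A (λ l → box B (λ k → f (k ℤ.- l) * g (k ℤ.+ l ℤ.+ ℤ.1ℤ)))
      ≈⟨ +-cong even odd ⟩
    _ ∎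
    where
    -- `suc N` instead of `N` leaves room for the unit shift in `shifted`, also when N = 0.
    A = suc N ℕ.+ suc N
    B = suc N ℕ.+ A
    f = term σ a (a ℕ.+ e ℕ.+ r)
    g = term σ (a ℕ.+ e) (a ℕ.+ r)
    a≤ : ∀ {m n} → 1 ≤ m → 1 ≤ m ℕ.+ n
    a≤ {m} {n} 1≤m = ℕ.≤-trans 1≤m (ℕ.m≤m+n m n)
    N≤A : N ≤ A
    N≤A = ℕ.m≤n⇒m≤1+n (ℕ.m≤m+n N (suc N))
    N≤B : N ≤ B
    N≤B = ℕ.m≤n⇒m≤1+n (ℕ.m≤m+n N A)
    N≤2A : N ≤ A ℕ.+ A
    N≤2A = ℕ.≤-trans N≤A (ℕ.m≤m+n A A)
    outside : ∀ m n → suc N ≤ ∣ m ∣ ⊎ suc N ≤ ∣ n ∣ → f m * g n ≈ 0#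
    outside m n (inj₁ N≤m) = trans (*-congʳ (term-vanishes σ 1≤a (a≤ (a≤ 1≤a)) m (ℕ.<⇒≤ N≤m))) (zeroˡ _)
    outside m n (inj₂ N≤n) = trans (*-congˡ (term-vanishes σ (a≤ 1≤a) (a≤ 1≤a) n (ℕ.<⇒≤ N≤n))) (zeroʳ _)

    u₀ = term 1# (a ℕ.+ a ℕ.+ e) (a ℕ.+ a ℕ.+ e ℕ.+ (r ℕ.+ r))
    v₀ = term 1# (a ℕ.+ a ℕ.+ (e ℕ.+ e) ℕ.+ r) (a ℕ.+ a ℕ.+ r)
    u₁ = term 1# (a ℕ.+ a ℕ.+ (a ℕ.+ a) ℕ.+ (e ℕ.+ e) ℕ.+ r) r
    v₁ = term 1# e (a ℕ.+ a ℕ.+ (a ℕ.+ a) ℕ.+ e ℕ.+ (r ℕ.+ r))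

    unsigned : ∀ c d k → term 1# c d k ≈ q ^ exponent c d k
    unsigned c d k = trans (*-congʳ (1^ ∣ k ∣)) (*-identityˡ _)

    even-term : ∀ k l → f (k ℤ.- l) * g (k ℤ.+ l) ≈ v₀ l * u₀ k
    even-term k l = begin
      x * q ^ X * (y * q ^ Y)
        ≈⟨ solve 4 (λ x X y Y → x :* X :* (y :* Y) := x :* y :* (X :* Y)) refl x (q ^ X) y (q ^ Y) ⟩
      x * y * (q ^ X * q ^ Y)
        ≈⟨ *-cong (sign-even σ²≈1 k l) (sym (^-homo-* q X Y)) ⟩
      1# * q ^ (X ℕ.+ Y)
        ≈⟨ trans (*-identityˡ _) (trans (^-congʳ q (exponents-even a e r k l)) (^-homo-* q U V)) ⟩
      q ^ U * q ^ V
        ≈⟨ *-cong (unsigned (a ℕ.+ a ℕ.+ e) _ k) (unsigned (a ℕ.+ a ℕ.+ (e ℕ.+ e) ℕ.+ r) _ l) ⟨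
      u₀ k * v₀ l
        ≈⟨ *-comm _ _ ⟩
      v₀ l * u₀ k ∎
      where
      x = σ ^ ∣ k ℤ.- l ∣
      y = σ ^ ∣ k ℤ.+ l ∣
      X = exponent a (a ℕ.+ e ℕ.+ r) (k ℤ.- l)
      Y = exponent (a ℕ.+ e) (a ℕ.+ r) (k ℤ.+ l)
      U = exponent (a ℕ.+ a ℕ.+ e) (a ℕ.+ a ℕ.+ e ℕ.+ (r ℕ.+ r)) k
      V = exponent (a ℕ.+ a ℕ.+ (e ℕ.+ e) ℕ.+ r) (a ℕ.+ a ℕ.+ r) l

    odd-term : ∀ k l → f (k ℤ.- l) * g (k ℤ.+ l ℤ.+ ℤ.1ℤ) ≈ σ * q ^ a * (v₁ (l ℤ.+ ℤ.1ℤ) * u₁ k)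
    odd-term k l = begin
      x * q ^ X * (y * q ^ Y)
        ≈⟨ solve 4 (λ x X y Y → x :* X :* (y :* Y) := x :* y :* (X :* Y)) refl x (q ^ X) y (q ^ Y) ⟩
      x * y * (q ^ X * q ^ Y)
        ≈⟨ *-cong (sign-odd σ²≈1 k l) (sym (^-homo-* q X Y)) ⟩
      σ * q ^ (X ℕ.+ Y)
        ≈⟨ *-congˡ (trans (^-congʳ q (exponents-odd a e r k l)) (trans (^-homo-* q a (U ℕ.+ V)) (*-congˡ (^-homo-* q U V)))) ⟩
      σ * (q ^ a * (q ^ U * q ^ V))
        ≈⟨ *-congˡ (*-congˡ (*-cong (unsigned (a ℕ.+ a ℕ.+ (a ℕ.+ a) ℕ.+ (e ℕ.+ e) ℕ.+ r) r k) (unsigned e _ (l ℤ.+ ℤ.1ℤ)))) ⟨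
      σ * (q ^ a * (u₁ k * v₁ (l ℤ.+ ℤ.1ℤ)))
        ≈⟨ solve 4 (λ s x u v → s :* (x :* (u :* v)) := s :* x :* (v :* u)) refl σ (q ^ a) (u₁ k) (v₁ (l ℤ.+ ℤ.1ℤ)) ⟩
      σ * q ^ a * (v₁ (l ℤ.+ ℤ.1ℤ) * u₁ k) ∎
      where
      x = σ ^ ∣ k ℤ.- l ∣
      y = σ ^ ∣ k ℤ.+ l ℤ.+ ℤ.1ℤ ∣
      X = exponent a (a ℕ.+ e ℕ.+ r) (k ℤ.- l)
      Y = exponent (a ℕ.+ e) (a ℕ.+ r) (k ℤ.+ l ℤ.+ ℤ.1ℤ)
      U = exponent (a ℕ.+ a ℕ.+ (a ℕ.+ a) ℕ.+ (e ℕ.+ e) ℕ.+ r) r k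
      V = exponent e (a ℕ.+ a ℕ.+ (a ℕ.+ a) ℕ.+ e ℕ.+ (r ℕ.+ r)) (l ℤ.+ ℤ.1ℤ)

    even : box A (λ l → box B (λ k → f (k ℤ.- l) * g (k ℤ.+ l)))
             ≈ θ 1# (a ℕ.+ a ℕ.+ e) (a ℕ.+ a ℕ.+ e ℕ.+ (r ℕ.+ r)) * θ 1# (a ℕ.+ a ℕ.+ (e ℕ.+ e) ℕ.+ r) (a ℕ.+ a ℕ.+ r)
    even = begin
      box A (λ l → box B (λ k → f (k ℤ.- l) * g (k ℤ.+ l)))
        ≈⟨ box-cong A (λ l _ → box-cong B (λ k _ → even-term k l)) ⟩
      box A (λ l → box B (λ k → v₀ l * u₀ k))
        ≈⟨ box-* A B v₀ u₀ ⟨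
      box A v₀ * box B u₀
        ≈⟨ *-comm _ _ ⟩
      box B u₀ * box A v₀
        ≈⟨ *-cong (θ-box 1# (a≤ (a≤ 1≤a)) (a≤ (a≤ (a≤ 1≤a))) N≤B) (θ-box 1# (a≤ (a≤ (a≤ 1≤a))) (a≤ (a≤ 1≤a)) N≤A) ⟨
      _ ∎

    odd : box A (λ l → box B (λ k → f (k ℤ.- l) * g (k ℤ.+ l ℤ.+ ℤ.1ℤ)))
             ≈ σ * q ^ a * (θ 1# (a ℕ.+ a ℕ.+ (a ℕ.+ a) ℕ.+ (e ℕ.+ e) ℕ.+ r) r * θ 1# e (a ℕ.+ a ℕ.+ (a ℕ.+ a) ℕ.+ e ℕ.+ (r ℕ.+ r)))
    odd = begin
      box A (λ l → box B (λ k → f (k ℤ.- l) * g (k ℤ.+ l ℤ.+ ℤ.1ℤ)))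
        ≈⟨ box-cong A (λ l _ → trans (box-cong B (λ k _ → odd-term k l)) (sym (box-*ˡ B _ (λ k → v₁ (l ℤ.+ ℤ.1ℤ) * u₁ k)))) ⟩
      box A (λ l → σ * q ^ a * box B (λ k → v₁ (l ℤ.+ ℤ.1ℤ) * u₁ k))
        ≈⟨ box-*ˡ A _ (λ l → box B (λ k → v₁ (l ℤ.+ ℤ.1ℤ) * u₁ k)) ⟨
      σ * q ^ a * box A (λ l → box B (λ k → v₁ (l ℤ.+ ℤ.1ℤ) * u₁ k))
        ≈⟨ *-congˡ (trans (sym (box-* A B (λ l → v₁ (l ℤ.+ ℤ.1ℤ)) u₁)) (*-comm _ _)) ⟩
      σ * q ^ a * (box B u₁ * box A (λ l → v₁ (l ℤ.+ ℤ.1ℤ)))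
        ≈⟨ *-congˡ (*-cong (sym (θ-box 1# (a≤ (a≤ (a≤ (a≤ 1≤a)))) 1≤r N≤B)) shifted) ⟩
      _ ∎
      where
      shifted : box A (λ l → v₁ (l ℤ.+ ℤ.1ℤ)) ≈ θ 1# e (a ℕ.+ a ℕ.+ (a ℕ.+ a) ℕ.+ e ℕ.+ (r ℕ.+ r))
      shifted = trans (box-shift ℤ.1ℤ v₁-vanishes 1+N≤A) (sym (θ-box 1# 1≤e (a≤ (a≤ (a≤ (a≤ 1≤a)))) N≤A))
        where
        v₁-vanishes = term-vanishes 1# 1≤e (a≤ (a≤ (a≤ (a≤ 1≤a))))
        1+N≤A = ℕ.+-mono-≤ (ℕ.n≤1+n N) (s≤s z≤n)

-- The three-term relation

m≡n+o⇒m∸n≡o : ∀ {m} n {o} → m ≡ n ℕ.+ o → m ∸ n ≡ o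
m≡n+o⇒m∸n≡o n {o} eq = ≡.trans (≡.cong (_∸ n) eq) (ℕ.m+n∸m≡n n o)

-- At most one occurrence is deleted: the lists are multisets of factors, and their difference
-- stands for division.
remove : ℕ → List ℕ → List ℕ
remove y []       = []
remove y (x ∷ xs) = if y ≡ᵇ x then xs else x ∷ remove y xs

infixl 5 _∖_
_∖_ : List ℕ → List ℕ → List ℕ
xs ∖ ys = foldr remove xs ys

-- J(a) in base 60: Sign.- stands for the factors 1 − q^k, and Sign.+ for 1 + q^k = (1 − q^2k) / (1 − q^k).
numerator denominator : Sign → ℕ → List ℕ
numerator Sign.-   a = a ∷ a ℕ.+ 30 ∷ (30 ∸ a) ∷ (30 ∸ a ℕ.+ 30) ∷ 30 ∷ 60 ∷ []
numerator Sign.+   a = a ℕ.+ a ∷ (30 ∸ a) ℕ.+ (30 ∸ a) ∷ 30 ∷ 60 ∷ []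
denominator Sign.- a = []
denominator Sign.+ a = a ∷ a ℕ.+ 30 ∷ (30 ∸ a) ∷ (30 ∸ a ℕ.+ 30) ∷ []

module ThreeTerm (R : CommutativeSemiring 0ℓ 0ℓ) (ν : CommutativeSemiring.Carrier R) (1+ν≈0 : IsMinusOne R ν)
  (N : ℕ) (q : CommutativeSemiring.Carrier R) (q^N≈0 : IsNilpotent R N q) where
  open CommutativeSemiring R
  open Exponent R
  open Theta R ν 1+ν≈0 N q q^N≈0
  open SetoidReasoning setoid
  open NaturalSolver R using (solve; _:=_; _:+_; _:*_; con)

  module _ (B : ℕ) where
    J : Carrier → ℕ → Carrier
    J σ a = θ σ a (B ∸ a)

    J² : Carrier → ℕ → ℕ → Carrier
    J² σ s t = J σ (s ∸ t) * J σ (s ℕ.+ t)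

    -- The entries of the determinant: theta functions with q^(2B) in place of q^B, each depending
    -- on one of s and t only. Neither depends on the sign σ.
    H₀ H₁ : ℕ → Carrier
    H₀ t = θ 1# (B ℕ.+ (t ℕ.+ t)) (B ∸ (t ℕ.+ t))
    H₁ s = θ 1# (s ℕ.+ s) (B ℕ.+ B ∸ (s ℕ.+ s))

  private
    -- This is `θ-multiplication` with a = s - t, e = 2t and r = B - 2s. Taking t, a and r as the
    -- parameters makes every truncated difference exact.
    J²-expand′ : ∀ {σ} t a r → let s = t ℕ.+ a; B = s ℕ.+ s ℕ.+ r in
      σ * σ ≈ 1# → 1 ≤ t → 1 ≤ a → 1 ≤ r →
      J² B σ s t ≈ H₁ B s * H₀ B t + σ * q ^ (s ∸ t) * (H₀ B s * H₁ B t)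
    J²-expand′ {σ} t a r σ²≈1 1≤t 1≤a 1≤r = begin
      J² B σ s t
        ≡⟨ ≡.cong₂ _*_
             (≡.cong₂ (θ σ) s∸t≡a (≡.trans (≡.cong (B ∸_) s∸t≡a) (m≡n+o⇒m∸n≡o a
               (solveℕ 3 (λ t a r → t ⊕ a ⊕ (t ⊕ a) ⊕ r ⊜ a ⊕ (a ⊕ (t ⊕ t) ⊕ r)) ≡.refl t a r))))
             (≡.cong₂ (θ σ) (solveℕ 2 (λ t a → t ⊕ a ⊕ t ⊜ a ⊕ (t ⊕ t)) ≡.refl t a) (m≡n+o⇒m∸n≡o (s ℕ.+ t)
               (solveℕ 3 (λ t a r → t ⊕ a ⊕ (t ⊕ a) ⊕ r ⊜ t ⊕ a ⊕ t ⊕ (a ⊕ r)) ≡.refl t a r))) ⟩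
      θ σ a (a ℕ.+ e ℕ.+ r) * θ σ (a ℕ.+ e) (a ℕ.+ r)
        ≈⟨ θ-multiplication a e r σ²≈1 1≤a (ℕ.≤-trans 1≤t (ℕ.m≤m+n t t)) 1≤r ⟩
      _
        ≡⟨ ≡.cong₂ _+_
             (≡.cong₂ _*_
               (≡.cong₂ (θ 1#) (solveℕ 2 (λ t a → a ⊕ a ⊕ (t ⊕ t) ⊜ t ⊕ a ⊕ (t ⊕ a)) ≡.refl t a) (≡.sym (m≡n+o⇒m∸n≡o (s ℕ.+ s)
                 (solveℕ 3 (λ t a r → t ⊕ a ⊕ (t ⊕ a) ⊕ r ⊕ (t ⊕ a ⊕ (t ⊕ a) ⊕ r) ⊜ t ⊕ a ⊕ (t ⊕ a) ⊕ (a ⊕ a ⊕ (t ⊕ t) ⊕ (r ⊕ r))) ≡.refl t a r))))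
               (≡.cong₂ (θ 1#) (solveℕ 3 (λ t a r → a ⊕ a ⊕ (t ⊕ t ⊕ (t ⊕ t)) ⊕ r ⊜ t ⊕ a ⊕ (t ⊕ a) ⊕ r ⊕ (t ⊕ t)) ≡.refl t a r) (≡.sym (m≡n+o⇒m∸n≡o (t ℕ.+ t)
                 (solveℕ 3 (λ t a r → t ⊕ a ⊕ (t ⊕ a) ⊕ r ⊜ t ⊕ t ⊕ (a ⊕ a ⊕ r)) ≡.refl t a r)))))
             (≡.cong₂ (λ n x → σ * q ^ n * x) (≡.sym s∸t≡a)
               (≡.cong₂ _*_
                 (≡.cong₂ (θ 1#) (solveℕ 3 (λ t a r → a ⊕ a ⊕ (a ⊕ a) ⊕ (t ⊕ t ⊕ (t ⊕ t)) ⊕ r ⊜ t ⊕ a ⊕ (t ⊕ a) ⊕ r ⊕ (t ⊕ a ⊕ (t ⊕ a))) ≡.refl t a r)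
                   (≡.sym (ℕ.m+n∸m≡n (s ℕ.+ s) r)))
                 (≡.cong (θ 1# e) (≡.sym (m≡n+o⇒m∸n≡o e
                   (solveℕ 3 (λ t a r → t ⊕ a ⊕ (t ⊕ a) ⊕ r ⊕ (t ⊕ a ⊕ (t ⊕ a) ⊕ r) ⊜ t ⊕ t ⊕ (a ⊕ a ⊕ (a ⊕ a) ⊕ (t ⊕ t) ⊕ (r ⊕ r))) ≡.refl t a r)))))) ⟩
      H₁ B s * H₀ B t + σ * q ^ (s ∸ t) * (H₀ B s * H₁ B t) ∎
      where
      open ℕ-Solver using () renaming (solve to solveℕ; _:+_ to _⊕_; _:=_ to _⊜_)
      s = t ℕ.+ a
      B = s ℕ.+ s ℕ.+ r
      e = t ℕ.+ t
      s∸t≡a = ℕ.m+n∸m≡n t a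

  J²-expand : ∀ {B σ s t} → σ * σ ≈ 1# → 1 ≤ t → t < s → s ℕ.+ s < B →
    J² B σ s t ≈ H₁ B s * H₀ B t + σ * q ^ (s ∸ t) * (H₀ B s * H₁ B t)
  J²-expand {B} {σ} {s} {t} σ²≈1 1≤t t<s 2s<B =
    go (s ∸ t) (B ∸ (s ℕ.+ s)) (ℕ.m+[n∸m]≡n (ℕ.<⇒≤ t<s)) (ℕ.m+[n∸m]≡n (ℕ.<⇒≤ 2s<B)) (ℕ.m<n⇒0<n∸m t<s) (ℕ.m<n⇒0<n∸m 2s<B)
    where
    go : ∀ a r → t ℕ.+ a ≡ s → s ℕ.+ s ℕ.+ r ≡ B → 1 ≤ a → 1 ≤ r →
         J² B σ s t ≈ H₁ B s * H₀ B t + σ * q ^ (s ∸ t) * (H₀ B s * H₁ B t)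
    go a r ≡.refl ≡.refl 1≤a 1≤r = J²-expand′ t a r σ²≈1 1≤t 1≤a 1≤r

  -- By J²-expand the J² are the 2 × 2 minors of a 2 × 4 matrix, so this is a Plücker relation.
  three-term : ∀ {B x y s₁ s₂ s₃ s₄} → x + y ≈ 0# → x * x ≈ 1# → y * y ≈ 1# →
    1 ≤ s₄ → s₄ < s₃ → s₃ < s₂ → s₂ < s₁ → s₁ ℕ.+ s₁ < B →
    J² B y s₁ s₃ * J² B y s₂ s₄ + q ^ (s₂ ∸ s₃) * (J² B x s₁ s₂ * J² B x s₃ s₄)
      ≈ J² B 1# s₁ s₄ * J² B 1# s₂ s₃
  three-term {B} {x} {y} {s₁} {s₂} {s₃} {s₄} x+y≈0 x²≈1 y²≈1 1≤s₄ s₄<s₃ s₃<s₂ s₂<s₁ 2s₁<B = begin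
    J² B y s₁ s₃ * J² B y s₂ s₄ + β * (J² B x s₁ s₂ * J² B x s₃ s₄)
      ≈⟨ +-cong (*-cong (trans (J²-expand y²≈1 1≤s₃ s₃<s₁ 2s₁<B) (+-congˡ (*-congʳ (*-congˡ q₁₃)))) (trans (J²-expand y²≈1 1≤s₄ s₄<s₂ 2s₂<B) (+-congˡ (*-congʳ (*-congˡ q₂₄)))))
                (*-congˡ (*-cong (J²-expand x²≈1 1≤s₂ s₂<s₁ 2s₁<B) (J²-expand x²≈1 1≤s₄ s₄<s₃ 2s₃<B))) ⟩
    (u₁ * v₃ + y * (α * β) * (v₁ * u₃)) * (u₂ * v₄ + y * (β * γ) * (v₂ * u₄)) + β * ((u₁ * v₂ + x * α * (v₁ * u₂)) * (u₃ * v₄ + x * γ * (v₃ * u₄)))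
      -- Of the eight products, those in u₁ u₄ v₂ v₃ and in u₂ u₃ v₁ v₄ occur once with x and once
      -- with y and cancel; the other four factor as the right-hand side.
      ≈⟨ solve 13 (λ x y α β γ u₁ u₂ u₃ u₄ v₁ v₂ v₃ v₄ →
           (u₁ :* v₃ :+ y :* (α :* β) :* (v₁ :* u₃)) :* (u₂ :* v₄ :+ y :* (β :* γ) :* (v₂ :* u₄)) :+ β :* ((u₁ :* v₂ :+ x :* α :* (v₁ :* u₂)) :* (u₃ :* v₄ :+ x :* γ :* (v₃ :* u₄)))
           := u₁ :* v₃ :* u₂ :* v₄ :+ y :* y :* (α :* β :* β :* γ :* v₁ :* u₃ :* v₂ :* u₄)
              :+ β :* u₁ :* v₂ :* u₃ :* v₄ :+ x :* x :* (β :* α :* v₁ :* u₂ :* γ :* v₃ :* u₄)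
              :+ (x :+ y) :* (β :* γ :* u₁ :* v₃ :* v₂ :* u₄ :+ α :* β :* v₁ :* u₃ :* u₂ :* v₄))
           refl x y α β γ u₁ u₂ u₃ u₄ v₁ v₂ v₃ v₄ ⟩
    u₁ * v₃ * u₂ * v₄ + y * y * (α * β * β * γ * v₁ * u₃ * v₂ * u₄) + β * u₁ * v₂ * u₃ * v₄
      + x * x * (β * α * v₁ * u₂ * γ * v₃ * u₄) + (x + y) * (β * γ * u₁ * v₃ * v₂ * u₄ + α * β * v₁ * u₃ * u₂ * v₄)
      ≈⟨ +-cong (+-cong (+-congʳ (+-congˡ (*-congʳ y²≈1))) (*-congʳ x²≈1)) (trans (*-congʳ x+y≈0) (zeroˡ _)) ⟩
    u₁ * v₃ * u₂ * v₄ + 1# * (α * β * β * γ * v₁ * u₃ * v₂ * u₄) + β * u₁ * v₂ * u₃ * v₄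
      + 1# * (β * α * v₁ * u₂ * γ * v₃ * u₄) + 0#
      ≈⟨ solve 11 (λ α β γ u₁ u₂ u₃ u₄ v₁ v₂ v₃ v₄ →
           u₁ :* v₃ :* u₂ :* v₄ :+ con 1 :* (α :* β :* β :* γ :* v₁ :* u₃ :* v₂ :* u₄) :+ β :* u₁ :* v₂ :* u₃ :* v₄
             :+ con 1 :* (β :* α :* v₁ :* u₂ :* γ :* v₃ :* u₄) :+ con 0
           := (u₁ :* v₄ :+ con 1 :* (α :* β :* γ) :* (v₁ :* u₄)) :* (u₂ :* v₃ :+ con 1 :* β :* (v₂ :* u₃)))
           refl α β γ u₁ u₂ u₃ u₄ v₁ v₂ v₃ v₄ ⟩
    (u₁ * v₄ + 1# * (α * β * γ) * (v₁ * u₄)) * (u₂ * v₃ + 1# * β * (v₂ * u₃))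
      ≈⟨ *-cong (trans (J²-expand (*-identityˡ 1#) 1≤s₄ s₄<s₁ 2s₁<B) (+-congˡ (*-congʳ (*-congˡ q₁₄)))) (J²-expand (*-identityˡ 1#) 1≤s₃ s₃<s₂ 2s₂<B) ⟨
    J² B 1# s₁ s₄ * J² B 1# s₂ s₃ ∎
    where
    u₁ = H₁ B s₁; u₂ = H₁ B s₂; u₃ = H₁ B s₃; u₄ = H₁ B s₄
    v₁ = H₀ B s₁; v₂ = H₀ B s₂; v₃ = H₀ B s₃; v₄ = H₀ B s₄
    α = q ^ (s₁ ∸ s₂)
    β = q ^ (s₂ ∸ s₃)
    γ = q ^ (s₃ ∸ s₄)
    s₃<s₁ = ℕ.<-trans s₃<s₂ s₂<s₁
    s₄<s₂ = ℕ.<-trans s₄<s₃ s₃<s₂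
    s₄<s₁ = ℕ.<-trans s₄<s₂ s₂<s₁
    1≤s₃ = ℕ.≤-trans 1≤s₄ (ℕ.<⇒≤ s₄<s₃)
    1≤s₂ = ℕ.≤-trans 1≤s₃ (ℕ.<⇒≤ s₃<s₂)
    2s₂<B = ℕ.<-trans (ℕ.+-mono-< s₂<s₁ s₂<s₁) 2s₁<B
    2s₃<B = ℕ.<-trans (ℕ.+-mono-< s₃<s₂ s₃<s₂) 2s₂<B
    gap : ∀ {l m n} → n < m → m < l → q ^ (l ∸ n) ≈ q ^ (l ∸ m) * q ^ (m ∸ n)
    gap {l} {m} {n} n<m m<l = trans (^-congʳ q (≡.trans (≡.cong (_∸ n) (≡.sym (ℕ.m∸n+n≡m (ℕ.<⇒≤ m<l)))) (ℕ.+-∸-assoc (l ∸ m) (ℕ.<⇒≤ n<m))))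
      (^-homo-* q (l ∸ m) (m ∸ n))
    q₁₃ = gap s₃<s₂ s₂<s₁
    q₂₄ = gap s₄<s₃ s₃<s₂
    q₁₄ = trans (gap s₄<s₃ s₃<s₁) (*-congʳ q₁₃)

-- Theta functions as quotients of products (q^a; q^60)_∞

numerator² denominator² : Sign → ℕ → ℕ → List ℕ
numerator²   σ s t = numerator   σ (s ∸ t) ++ numerator   σ (s ℕ.+ t)
denominator² σ s t = denominator σ (s ∸ t) ++ denominator σ (s ℕ.+ t)

module Products (R : CommutativeSemiring 0ℓ 0ℓ) (ν : CommutativeSemiring.Carrier R) (1+ν≈0 : IsMinusOne R ν)
  (N : ℕ) (q : CommutativeSemiring.Carrier R) (q^N≈0 : IsNilpotent R N q) where
  open CommutativeSemiring R
  open Exponent R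
  open Theta R ν 1+ν≈0 N q q^N≈0
  open ThreeTerm R ν 1+ν≈0 N q q^N≈0
  open SetoidReasoning setoid
  open NaturalSolver R using (solve; _:=_; _:+_; _:*_; con)

  module _ {s t F G x : Carrier} (sF≈1 : s * F ≈ 1#) (tG≈1 : t * G ≈ 1#) where

    private
      inverse-t : t * (F * G) ≈ F
      inverse-t = begin
        t * (F * G)          ≈⟨ solve 3 (λ t F G → t :* (F :* G) := F :* (t :* G)) refl t F G ⟩
        F * (t * G)          ≈⟨ trans (*-congˡ tG≈1) (*-identityʳ F) ⟩
        F                    ∎

    shifted-inverses : s * t + x * s ≈ t → 1# + x * G ≈ F
    shifted-inverses eq = begin
      1# + x * G                             ≈⟨ +-cong (trans (*-cong sF≈1 tG≈1) (*-identityˡ 1#)) (*-congˡ (trans (*-congˡ sF≈1) (*-identityʳ G))) ⟨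
      s * F * (t * G) + x * (G * (s * F))    ≈⟨ solve 5 (λ s t F G x → s :* F :* (t :* G) :+ x :* (G :* (s :* F)) := (s :* t :+ x :* s) :* (F :* G)) refl s t F G x ⟩
      (s * t + x * s) * (F * G)              ≈⟨ *-congʳ eq ⟩
      t * (F * G)                            ≈⟨ inverse-t ⟩
      F                                      ∎

    shiftless-inverses : s + x * (s * t) ≈ t → G + x ≈ F
    shiftless-inverses eq = begin
      G + x                                  ≈⟨ +-cong (trans (*-congˡ sF≈1) (*-identityʳ G)) (trans (*-congˡ (trans (*-cong sF≈1 tG≈1) (*-identityˡ 1#))) (*-identityʳ x)) ⟨
      G * (s * F) + x * (s * F * (t * G))    ≈⟨ solve 5 (λ s t F G x → G :* (s :* F) :+ x :* (s :* F :* (t :* G)) := (s :+ x :* (s :* t)) :* (F :* G)) refl s t F G x ⟩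
      (s + x * (s * t)) * (F * G)            ≈⟨ *-congʳ eq ⟩
      t * (F * G)                            ≈⟨ inverse-t ⟩
      F                                      ∎

  -- The infinite product (q^a; q^60)_∞; modulo q^N all factors from j = N on are 1.
  φ : ℕ → Carrier
  φ a = ∏ N (λ j → 1# + ν * q ^ (a ℕ.+ j ℕ.* 60))

  -- With products of φ's encoded as lists of indices, two products are recognised as equal by
  -- evaluating `sort` on both lists.
  monomial : List ℕ → Carrier
  monomial = foldr (λ a x → φ a * x) 1#

  monomial-++ : ∀ xs ys → monomial (xs ++ ys) ≈ monomial xs * monomial ys
  monomial-++ []       ys = sym (*-identityˡ _)
  monomial-++ (x ∷ xs) ys = trans (*-congˡ (monomial-++ xs ys)) (sym (*-assoc _ _ _))

  monomial-↭ : ∀ {xs ys} → xs ↭ ys → monomial xs ≈ monomial ys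
  monomial-↭ ↭.refl         = refl
  monomial-↭ (prep x p)     = *-congˡ (monomial-↭ p)
  monomial-↭ (swap x y p)   = trans (*-congˡ (*-congˡ (monomial-↭ p)))
    (solve 3 (λ x y z → x :* (y :* z) := y :* (x :* z)) refl (φ x) (φ y) _)
  monomial-↭ (↭.trans p p′) = trans (monomial-↭ p) (monomial-↭ p′)

  monomial-sort : ∀ xs ys → sort xs ≡ sort ys → monomial xs ≈ monomial ys
  monomial-sort xs ys eq = trans (monomial-↭ (↭.↭-sym (sort-↭ xs)))
    (trans (reflexive (≡.cong monomial eq)) (monomial-↭ (sort-↭ ys)))

  φ-invertible : ∀ {a} → 1 ≤ a → ∃ λ y → y * φ a ≈ 1#
  φ-invertible {suc a} _ = ∏ N (λ j → geometric (q ^ (suc a ℕ.+ j ℕ.* 60))) ,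
    trans (*-comm _ _) (trans (sym (Product.big-∙ N _ _)) (Product.big-ε N (λ j _ → 1-x*geometric (nil-^ (a ℕ.+ j ℕ.* 60) q^N≈0))))

  monomial-invertible : ∀ {xs} → All (1 ≤_) xs → ∃ λ y → y * monomial xs ≈ 1#
  monomial-invertible []               = 1# , *-identityˡ 1#
  monomial-invertible (1≤x ∷ 1≤xs) with φ-invertible 1≤x | monomial-invertible 1≤xs
  ... | y , y*φ≈1 | z , z*xs≈1 = y * z , trans (solve 4 (λ y z a b → y :* z :* (a :* b) := (y :* a) :* (z :* b)) refl y z _ _)
    (trans (*-cong y*φ≈1 z*xs≈1) (*-identityˡ 1#))

  -- Cancellation has to go through an inverse, since the nilpotent q produces zero divisors.
  -- Positive indices make each factor 1 minus a nilpotent element; an index 0 would contribute 1 -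
  -- 1.
  monomial-cancel : ∀ {xs x y} → All (1 ≤_) xs → monomial xs * x ≈ monomial xs * y → x ≈ y
  monomial-cancel {xs} {x} {y} 1≤xs eq with monomial-invertible 1≤xs
  ... | z , z*xs≈1 = begin
    x                        ≈⟨ *-identityˡ x ⟨
    1# * x                   ≈⟨ *-congʳ z*xs≈1 ⟨
    z * monomial xs * x      ≈⟨ *-assoc _ _ _ ⟩
    z * (monomial xs * x)    ≈⟨ *-congˡ eq ⟩
    z * (monomial xs * y)    ≈⟨ *-assoc _ _ _ ⟨
    z * monomial xs * y      ≈⟨ *-congʳ z*xs≈1 ⟩
    1# * y                   ≈⟨ *-identityˡ y ⟩
    y                        ∎

  ⟦_⟧ : Sign → Carrier
  ⟦ Sign.+ ⟧ = 1#
  ⟦ Sign.- ⟧ = ν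

  ⟦⟧²≈1 : ∀ s → ⟦ s ⟧ * ⟦ s ⟧ ≈ 1#
  ⟦⟧²≈1 Sign.+ = *-identityˡ 1#
  ⟦⟧²≈1 Sign.- = ν²≈1

  ⟦⟧-opposite : ∀ s → ⟦ s ⟧ + ⟦ Sign.opposite s ⟧ ≈ 0#
  ⟦⟧-opposite Sign.+ = 1+ν≈0
  ⟦⟧-opposite Sign.- = trans (+-comm _ _) 1+ν≈0

  step-power : ∀ e k → q ^ e * (q ^ 30) ^ k ≈ q ^ (e ℕ.+ k ℕ.* 30)
  step-power e k = begin
    q ^ e * (q ^ 30) ^ k          ≈⟨ *-congˡ (^-assocʳ q 30 k) ⟩
    q ^ e * q ^ (30 ℕ.* k)        ≈⟨ ^-homo-* q e _ ⟨
    q ^ (e ℕ.+ 30 ℕ.* k)          ≈⟨ ^-congʳ q (≡.cong (e ℕ.+_) (ℕ.*-comm 30 k)) ⟩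
    q ^ (e ℕ.+ k ℕ.* 30)          ∎

  ∏-split : ∀ e → ∏ (N ℕ.* 2) (λ k → 1# + ν * q ^ (e ℕ.+ k ℕ.* 30)) ≈ φ e * φ (e ℕ.+ 30)
  ∏-split e = begin
    ∏ (N ℕ.* 2) (λ k → 1# + ν * q ^ (e ℕ.+ k ℕ.* 30))
      ≈⟨ Product.big-blocks N 2 _ ⟩
    ∏ N (λ j → 1# * (1# + ν * q ^ (e ℕ.+ (j ℕ.* 2 ℕ.+ 0) ℕ.* 30)) * (1# + ν * q ^ (e ℕ.+ (j ℕ.* 2 ℕ.+ 1) ℕ.* 30)))
      ≈⟨ Product.big-cong′ N (λ j → *-cong
           (trans (*-identityˡ _) (+-congˡ (*-congˡ (^-congʳ q (solveℕ 2 (λ e j → e ⊕ (j ⊛ conℕ 2 ⊕ conℕ 0) ⊛ conℕ 30 ⊜ e ⊕ j ⊛ conℕ 60) ≡.refl e j)))))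
           (+-congˡ (*-congˡ (^-congʳ q (solveℕ 2 (λ e j → e ⊕ (j ⊛ conℕ 2 ⊕ conℕ 1) ⊛ conℕ 30 ⊜ e ⊕ conℕ 30 ⊕ j ⊛ conℕ 60) ≡.refl e j))))) ⟩
    ∏ N (λ j → (1# + ν * q ^ (e ℕ.+ j ℕ.* 60)) * (1# + ν * q ^ (e ℕ.+ 30 ℕ.+ j ℕ.* 60)))
      ≈⟨ Product.big-∙ N _ _ ⟩
    φ e * φ (e ℕ.+ 30) ∎
    where open ℕ-Solver using () renaming (solve to solveℕ; _:+_ to _⊕_; _:*_ to _⊛_; _:=_ to _⊜_; con to conℕ)

  -- By (1 + x)(1 - x) = 1 - x² the exponents e + 30k double to 2e + 60k. Of the resulting 2N
  -- factors in base 60, the last N are trivial modulo q^N.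
  ∏-plus-minus : ∀ e → ∏ (N ℕ.* 2) (λ k → 1# + q ^ (e ℕ.+ k ℕ.* 30)) * (φ e * φ (e ℕ.+ 30)) ≈ φ (e ℕ.+ e)
  ∏-plus-minus e = begin
    ∏ (N ℕ.* 2) (λ k → 1# + q ^ (e ℕ.+ k ℕ.* 30)) * (φ e * φ (e ℕ.+ 30))
      ≈⟨ *-congˡ (∏-split e) ⟨
    ∏ (N ℕ.* 2) (λ k → 1# + q ^ (e ℕ.+ k ℕ.* 30)) * ∏ (N ℕ.* 2) (λ k → 1# + ν * q ^ (e ℕ.+ k ℕ.* 30))
      ≈⟨ Product.big-∙ (N ℕ.* 2) _ _ ⟨
    ∏ (N ℕ.* 2) (λ k → (1# + q ^ (e ℕ.+ k ℕ.* 30)) * (1# + ν * q ^ (e ℕ.+ k ℕ.* 30)))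
      ≈⟨ Product.big-cong′ (N ℕ.* 2) difference-of-squares ⟩
    ∏ (N ℕ.* 2) h
      ≡⟨ ≡.cong (λ n → ∏ n h) (≡.trans (ℕ.*-comm N 2) (≡.cong (N ℕ.+_) (ℕ.+-identityʳ N))) ⟩
    ∏ (N ℕ.+ N) h
      ≈⟨ Product.big-prefix N N h (λ i → trans (+-congˡ (trans (*-congˡ (nil-≥ q^N≈0 (far i))) (zeroʳ ν))) (+-identityʳ 1#)) ⟩
    φ (e ℕ.+ e) ∎
    where
    open ℕ-Solver using () renaming (solve to solveℕ; _:+_ to _⊕_; _:*_ to _⊛_; _:=_ to _⊜_; con to conℕ)
    h : ℕ → Carrier
    h j = 1# + ν * q ^ (e ℕ.+ e ℕ.+ j ℕ.* 60)
    far : ∀ i → N ≤ e ℕ.+ e ℕ.+ (N ℕ.+ i) ℕ.* 60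
    far i = ℕ.≤-trans (ℕ.m≤m+n N i) (ℕ.≤-trans (ℕ.m≤m*n (N ℕ.+ i) 60) (ℕ.m≤n+m _ (e ℕ.+ e)))
    difference-of-squares : ∀ k → (1# + q ^ (e ℕ.+ k ℕ.* 30)) * (1# + ν * q ^ (e ℕ.+ k ℕ.* 30)) ≈ h k
    difference-of-squares k = begin
      (1# + x) * (1# + ν * x)         ≈⟨ solve 2 (λ x v → (con 1 :+ x) :* (con 1 :+ v :* x) := con 1 :+ v :* (x :* x) :+ (con 1 :+ v) :* x) refl x ν ⟩
      1# + ν * (x * x) + (1# + ν) * x ≈⟨ cancel-ν _ x ⟩
      1# + ν * (x * x)                ≈⟨ +-congˡ (*-congˡ (trans (sym (^-homo-* q n n)) (^-congʳ q
                                           (solveℕ 2 (λ e k → e ⊕ k ⊛ conℕ 30 ⊕ (e ⊕ k ⊛ conℕ 30) ⊜ e ⊕ e ⊕ k ⊛ conℕ 60) ≡.refl e k)))) ⟩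
      h k                             ∎
      where
      n = e ℕ.+ k ℕ.* 30
      x = q ^ n

  θ-product₃₀ : ∀ {σ c d} → σ * σ ≈ 1# → 1 ≤ c → 1 ≤ d → c ℕ.+ d ≡ 30 →
    θ σ c d ≈ ∏ (N ℕ.* 2) (λ k → 1# + σ * q ^ (d ℕ.+ k ℕ.* 30)) * ∏ (N ℕ.* 2) (λ k → 1# + σ * q ^ (c ℕ.+ k ℕ.* 30)) * (φ 30 * φ 60)
  θ-product₃₀ {σ} {c} {d} σ²≈1 1≤c 1≤d c+d≡30 = begin
    θ σ c d
      ≈⟨ θ-product {M = N ℕ.* 2} σ²≈1 1≤c 1≤d (ℕ.≤-reflexive (≡.sym (≡.trans (ℕ.*-comm N 2) (≡.cong (N ℕ.+_) (ℕ.+-identityʳ N))))) ⟩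
    _
      ≡⟨ ≡.cong (λ Q → ∏ (N ℕ.* 2) (λ k → 1# + σ * q ^ d * (q ^ Q) ^ k) * ∏ (N ℕ.* 2) (λ k → 1# + σ * q ^ c * (q ^ Q) ^ k)
                        * ∏ (N ℕ.* 2) (λ k → 1# + ν * (q ^ Q) ^ suc k)) c+d≡30 ⟩
    ∏ (N ℕ.* 2) (λ k → 1# + σ * q ^ d * (q ^ 30) ^ k) * ∏ (N ℕ.* 2) (λ k → 1# + σ * q ^ c * (q ^ 30) ^ k)
      * ∏ (N ℕ.* 2) (λ k → 1# + ν * (q ^ 30) ^ suc k)
      ≈⟨ *-cong (*-cong (linear d) (linear c)) (trans (Product.big-cong′ (N ℕ.* 2) (λ k → +-congˡ (*-congˡ (step-power 30 k)))) (∏-split 30)) ⟩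
    _ ∎
    where
    linear : ∀ e → ∏ (N ℕ.* 2) (λ k → 1# + σ * q ^ e * (q ^ 30) ^ k) ≈ ∏ (N ℕ.* 2) (λ k → 1# + σ * q ^ (e ℕ.+ k ℕ.* 30))
    linear e = Product.big-cong′ (N ℕ.* 2) (λ k → +-congˡ (trans (*-assoc _ _ _) (*-congˡ (step-power e k))))

  J-quotient : ∀ s {a} → 1 ≤ a → a < 30 → J 30 ⟦ s ⟧ a * monomial (denominator s a) ≈ monomial (numerator s a)
  J-quotient Sign.- {a} 1≤a a<30 = begin
    θ ν a b * 1#
      ≈⟨ *-identityʳ _ ⟩
    θ ν a b
      ≈⟨ θ-product₃₀ ν²≈1 1≤a (ℕ.m<n⇒0<n∸m a<30) (ℕ.m+[n∸m]≡n (ℕ.<⇒≤ a<30)) ⟩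
    ∏ (N ℕ.* 2) (λ k → 1# + ν * q ^ (b ℕ.+ k ℕ.* 30)) * ∏ (N ℕ.* 2) (λ k → 1# + ν * q ^ (a ℕ.+ k ℕ.* 30)) * (φ 30 * φ 60)
      ≈⟨ *-congʳ (*-cong (∏-split b) (∏-split a)) ⟩
    φ b * φ (b ℕ.+ 30) * (φ a * φ (a ℕ.+ 30)) * (φ 30 * φ 60)
      ≈⟨ solve 6 (λ a a′ b b′ x y → b :* b′ :* (a :* a′) :* (x :* y) := a :* (a′ :* (b :* (b′ :* (x :* (y :* con 1))))))
           refl (φ a) (φ (a ℕ.+ 30)) (φ b) (φ (b ℕ.+ 30)) (φ 30) (φ 60) ⟩
    monomial (numerator Sign.- a) ∎
    where b = 30 ∸ a
  J-quotient Sign.+ {a} 1≤a a<30 = begin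
    θ 1# a b * monomial (denominator Sign.+ a)
      ≈⟨ *-congʳ (θ-product₃₀ (*-identityˡ 1#) 1≤a (ℕ.m<n⇒0<n∸m a<30) (ℕ.m+[n∸m]≡n (ℕ.<⇒≤ a<30))) ⟩
    ∏ (N ℕ.* 2) (λ k → 1# + 1# * q ^ (b ℕ.+ k ℕ.* 30)) * ∏ (N ℕ.* 2) (λ k → 1# + 1# * q ^ (a ℕ.+ k ℕ.* 30)) * (φ 30 * φ 60) * monomial (denominator Sign.+ a)
      ≈⟨ *-congʳ (*-congʳ (*-cong (unit b) (unit a))) ⟩
    pb * pa * (φ 30 * φ 60) * monomial (denominator Sign.+ a)
      ≈⟨ solve 8 (λ pa pb a a′ b b′ x y → pb :* pa :* (x :* y) :* (a :* (a′ :* (b :* (b′ :* con 1))))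
                   := pa :* (a :* a′) :* (pb :* (b :* b′) :* (x :* (y :* con 1))))
           refl pa pb (φ a) (φ (a ℕ.+ 30)) (φ b) (φ (b ℕ.+ 30)) (φ 30) (φ 60) ⟩
    pa * (φ a * φ (a ℕ.+ 30)) * (pb * (φ b * φ (b ℕ.+ 30)) * (φ 30 * (φ 60 * 1#)))
      ≈⟨ *-cong (∏-plus-minus a) (*-congʳ (∏-plus-minus b)) ⟩
    monomial (numerator Sign.+ a) ∎
    where
    b = 30 ∸ a
    pa = ∏ (N ℕ.* 2) (λ k → 1# + q ^ (a ℕ.+ k ℕ.* 30))
    pb = ∏ (N ℕ.* 2) (λ k → 1# + q ^ (b ℕ.+ k ℕ.* 30))
    unit : ∀ e → ∏ (N ℕ.* 2) (λ k → 1# + 1# * q ^ (e ℕ.+ k ℕ.* 30)) ≈ ∏ (N ℕ.* 2) (λ k → 1# + q ^ (e ℕ.+ k ℕ.* 30))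
    unit e = Product.big-cong′ (N ℕ.* 2) (λ k → +-congˡ (*-identityˡ _))

  *-quotient : ∀ {x y n₁ n₂ d₁ d₂} → x * monomial d₁ ≈ monomial n₁ → y * monomial d₂ ≈ monomial n₂ →
    x * y * monomial (d₁ ++ d₂) ≈ monomial (n₁ ++ n₂)
  *-quotient {x} {y} {n₁} {n₂} {d₁} {d₂} eq₁ eq₂ = begin
    x * y * monomial (d₁ ++ d₂)                 ≈⟨ *-congˡ (monomial-++ d₁ d₂) ⟩
    x * y * (monomial d₁ * monomial d₂)         ≈⟨ solve 4 (λ x y a b → x :* y :* (a :* b) := x :* a :* (y :* b)) refl x y _ _ ⟩
    x * monomial d₁ * (y * monomial d₂)         ≈⟨ *-cong eq₁ eq₂ ⟩
    monomial n₁ * monomial n₂                   ≈⟨ monomial-++ n₁ n₂ ⟨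
    monomial (n₁ ++ n₂)                         ∎

  J²-quotient : ∀ σ {s t} → t < s → s ℕ.+ s < 30 →
    J² 30 ⟦ σ ⟧ s t * monomial (denominator² σ s t) ≈ monomial (numerator² σ s t)
  J²-quotient σ {s} {t} t<s 2s<30 = *-quotient {n₁ = numerator σ (s ∸ t)} {numerator σ (s ℕ.+ t)} {denominator σ (s ∸ t)} {denominator σ (s ℕ.+ t)}
    (J-quotient σ (ℕ.m<n⇒0<n∸m t<s) (ℕ.≤-<-trans (ℕ.m∸n≤m s t) (ℕ.≤-<-trans (ℕ.m≤m+n s s) 2s<30)))
    (J-quotient σ (ℕ.≤-trans (ℕ.≤-trans (s≤s z≤n) t<s) (ℕ.m≤m+n s t)) (ℕ.<-trans (ℕ.+-monoʳ-< s t<s) 2s<30))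

  module _ (σ : Sign) (s₁ s₂ s₃ s₄ : ℕ) where
    private τ = Sign.opposite σ

    numerator₁ numerator₂ numerator₃ denominator₁ denominator₂ denominator₃ : List ℕ
    numerator₁   = numerator²   τ s₁ s₃ ++ numerator²   τ s₂ s₄
    numerator₂   = numerator²   σ s₁ s₂ ++ numerator²   σ s₃ s₄
    numerator₃   = numerator²   Sign.+ s₁ s₄ ++ numerator²   Sign.+ s₂ s₃
    denominator₁ = denominator² τ s₁ s₃ ++ denominator² τ s₂ s₄
    denominator₂ = denominator² σ s₁ s₂ ++ denominator² σ s₃ s₄
    denominator₃ = denominator² Sign.+ s₁ s₄ ++ denominator² Sign.+ s₂ s₃

    -- Each numerator is multiplied by the denominators of the other two terms, so that the relation
    -- becomes one between products.
    term₁ term₂ term₃ : List ℕ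
    term₁ = numerator₁ ++ denominator₂ ++ denominator₃
    term₂ = numerator₂ ++ denominator₁ ++ denominator₃
    term₃ = numerator₃ ++ denominator₁ ++ denominator₂

    three-term-monomials : 1 ≤ s₄ → s₄ < s₃ → s₃ < s₂ → s₂ < s₁ → s₁ ℕ.+ s₁ < 30 →
      monomial term₁ + q ^ (s₂ ∸ s₃) * monomial term₂ ≈ monomial term₃
    three-term-monomials 1≤s₄ s₄<s₃ s₃<s₂ s₂<s₁ 2s₁<30 = begin
      monomial term₁ + y * monomial term₂
        ≈⟨ +-cong (expand numerator₁ denominator₁ denominator₂ denominator₃ Y-quotient)
                  (*-congˡ (expand numerator₂ denominator₂ denominator₁ denominator₃ X-quotient)) ⟩
      Y * d₁ * (d₂ * d₃) + y * (X * d₂ * (d₁ * d₃))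
        ≈⟨ solve 6 (λ X Y y a b c → Y :* a :* (b :* c) :+ y :* (X :* b :* (a :* c)) := (Y :+ y :* X) :* c :* (a :* b))
             refl X Y y d₁ d₂ d₃ ⟩
      (Y + y * X) * d₃ * (d₁ * d₂)
        ≈⟨ *-congʳ (*-congʳ (three-term {30} (⟦⟧-opposite σ) (⟦⟧²≈1 σ) (⟦⟧²≈1 τ) 1≤s₄ s₄<s₃ s₃<s₂ s₂<s₁ 2s₁<30)) ⟩
      Z * d₃ * (d₁ * d₂)
        ≈⟨ expand numerator₃ denominator₃ denominator₁ denominator₂ Z-quotient ⟨
      monomial term₃ ∎
      where
      y = q ^ (s₂ ∸ s₃)
      X = J² 30 ⟦ σ ⟧ s₁ s₂ * J² 30 ⟦ σ ⟧ s₃ s₄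
      Y = J² 30 ⟦ τ ⟧ s₁ s₃ * J² 30 ⟦ τ ⟧ s₂ s₄
      Z = J² 30 1# s₁ s₄ * J² 30 1# s₂ s₃
      d₁ = monomial denominator₁
      d₂ = monomial denominator₂
      d₃ = monomial denominator₃
      2s₂<30 = ℕ.<-trans (ℕ.+-mono-< s₂<s₁ s₂<s₁) 2s₁<30
      2s₃<30 = ℕ.<-trans (ℕ.+-mono-< s₃<s₂ s₃<s₂) 2s₂<30
      s₃<s₁ = ℕ.<-trans s₃<s₂ s₂<s₁
      s₄<s₂ = ℕ.<-trans s₄<s₃ s₃<s₂
      X-quotient = *-quotient {n₁ = numerator² σ s₁ s₂} {numerator² σ s₃ s₄} {denominator² σ s₁ s₂} {denominator² σ s₃ s₄}
        (J²-quotient σ s₂<s₁ 2s₁<30) (J²-quotient σ s₄<s₃ 2s₃<30)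
      Y-quotient = *-quotient {n₁ = numerator² τ s₁ s₃} {numerator² τ s₂ s₄} {denominator² τ s₁ s₃} {denominator² τ s₂ s₄}
        (J²-quotient τ s₃<s₁ 2s₁<30) (J²-quotient τ s₄<s₂ 2s₂<30)
      Z-quotient = *-quotient {n₁ = numerator² Sign.+ s₁ s₄} {numerator² Sign.+ s₂ s₃} {denominator² Sign.+ s₁ s₄} {denominator² Sign.+ s₂ s₃}
        (J²-quotient Sign.+ (ℕ.<-trans s₄<s₂ s₂<s₁) 2s₁<30) (J²-quotient Sign.+ s₃<s₂ 2s₂<30)
      expand : ∀ {x} n d e f → x * monomial d ≈ monomial n →
        monomial (n ++ e ++ f) ≈ x * monomial d * (monomial e * monomial f)
      expand n d e f eq = trans (monomial-++ n (e ++ f)) (*-cong (sym eq) (monomial-++ e f))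

    -- Multiplied by extra, the three monomials above acquire the common factor common.
    reduced-three-term : ∀ A B C → let extra = C ∖ term₃; common = (extra ++ term₃) ∖ C in
      {True (1 ≤? s₄)} → {True (s₄ <? s₃)} → {True (s₃ <? s₂)} → {True (s₂ <? s₁)} → {True (s₁ ℕ.+ s₁ <? 30)} →
      {True (All.all? (1 ≤?_) common)} →
      sort (extra ++ term₁) ≡ sort (common ++ A) →
      sort (extra ++ term₂) ≡ sort (common ++ B) →
      sort (extra ++ term₃) ≡ sort (common ++ C) →
      monomial A + q ^ (s₂ ∸ s₃) * monomial B ≈ monomial C
    reduced-three-term A B C {1≤s₄} {s₄<s₃} {s₃<s₂} {s₂<s₁} {2s₁<30} {1≤common} eq₁ eq₂ eq₃ =
      monomial-cancel (toWitness 1≤common) (begin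
        monomial common * (monomial A + y * monomial B)
          ≈⟨ solve 4 (λ c a y b → c :* (a :+ y :* b) := c :* a :+ y :* (c :* b)) refl _ _ y _ ⟩
        monomial common * monomial A + y * (monomial common * monomial B)
          ≈⟨ +-cong (absorb term₁ A eq₁) (*-congˡ (absorb term₂ B eq₂)) ⟨
        monomial extra * monomial term₁ + y * (monomial extra * monomial term₂)
          ≈⟨ solve 4 (λ c a y b → c :* (a :+ y :* b) := c :* a :+ y :* (c :* b)) refl _ _ y _ ⟨
        monomial extra * (monomial term₁ + y * monomial term₂)
          ≈⟨ *-congˡ (three-term-monomials (toWitness 1≤s₄) (toWitness s₄<s₃) (toWitness s₃<s₂) (toWitness s₂<s₁) (toWitness 2s₁<30)) ⟩
        monomial extra * monomial term₃
          ≈⟨ absorb term₃ C eq₃ ⟩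
        monomial common * monomial C ∎)
      where
      y = q ^ (s₂ ∸ s₃)
      extra = C ∖ term₃
      common = (extra ++ term₃) ∖ C
      absorb : ∀ t A → sort (extra ++ t) ≡ sort (common ++ A) → monomial extra * monomial t ≈ monomial common * monomial A
      absorb t A eq = trans (sym (monomial-++ extra t)) (trans (monomial-sort (extra ++ t) (common ++ A) eq) (monomial-++ common A))

-- Formal power series

Series : Set
Series = ℕ → ℤ

infixl 6 _⊕_
infixl 7 _⊛_

-- The Cauchy product by recursion on the degree, through f = f(0) + X · (f ∘ suc).
_⊕_ _⊛_ : Series → Series → Series
(f ⊕ g) n       = f n ℤ.+ g n
(f ⊛ g) zero    = f 0 ℤ.* g 0
(f ⊛ g) (suc n) = f 0 ℤ.* g (suc n) ℤ.+ ((f ∘ suc) ⊛ g) n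

constant : ℤ → Series
constant c zero    = c
constant c (suc _) = 0ℤ

constant-0 : ∀ n → constant 0ℤ n ≡ 0ℤ
constant-0 zero    = ≡.refl
constant-0 (suc n) = ≡.refl

X : Series
X zero    = 0ℤ
X (suc n) = constant 1ℤ n

module _ where
  open ≡.≡-Reasoning
  open +-*-Solver

  ⊛-cong : ∀ n {f f′ g g′} → (∀ k → k ≤ n → f k ≡ f′ k) → (∀ k → k ≤ n → g k ≡ g′ k) → (f ⊛ g) n ≡ (f′ ⊛ g′) n
  ⊛-cong zero    f≡ g≡ = ≡.cong₂ ℤ._*_ (f≡ 0 z≤n) (g≡ 0 z≤n)
  ⊛-cong (suc n) f≡ g≡ = ≡.cong₂ ℤ._+_ (≡.cong₂ ℤ._*_ (f≡ 0 z≤n) (g≡ (suc n) ℕ.≤-refl))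
    (⊛-cong n (λ k k≤n → f≡ (suc k) (s≤s k≤n)) (λ k k≤n → g≡ k (ℕ.m≤n⇒m≤1+n k≤n)))

  ⊛-zeroˡ : ∀ g n → (constant 0ℤ ⊛ g) n ≡ 0ℤ
  ⊛-zeroˡ g zero    = ≡.refl
  ⊛-zeroˡ g (suc n) = ≡.trans (ℤ.+-identityˡ (((constant 0ℤ ∘ suc) ⊛ g) n))
    (≡.trans (⊛-cong n {g = g} (λ { zero _ → ≡.refl ; (suc k) _ → ≡.refl }) (λ _ _ → ≡.refl)) (⊛-zeroˡ g n))

  constant-⊛ : ∀ c g n → (constant c ⊛ g) n ≡ c ℤ.* g n
  constant-⊛ c g zero    = ≡.refl
  constant-⊛ c g (suc n) = ≡.trans (≡.cong (ℤ._+_ (c ℤ.* g (suc n)))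
    (≡.trans (⊛-cong n {g = g} (λ { zero _ → ≡.refl ; (suc k) _ → ≡.refl }) (λ _ _ → ≡.refl)) (⊛-zeroˡ g n)))
    (ℤ.+-identityʳ (c ℤ.* g (suc n)))

  ⊛-identityˡ : ∀ g n → (constant 1ℤ ⊛ g) n ≡ g n
  ⊛-identityˡ g n = ≡.trans (constant-⊛ 1ℤ g n) (ℤ.*-identityˡ (g n))

  ⊛-distribʳ : ∀ h f g n → ((f ⊕ g) ⊛ h) n ≡ (f ⊛ h) n ℤ.+ (g ⊛ h) n
  ⊛-distribʳ h f g zero    = ℤ.*-distribʳ-+ (h 0) (f 0) (g 0)
  ⊛-distribʳ h f g (suc n) = ≡.trans (≡.cong (ℤ._+_ ((f 0 ℤ.+ g 0) ℤ.* h (suc n))) (⊛-distribʳ h (f ∘ suc) (g ∘ suc) n))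
    (solve 5 (λ f g h x y → (f :+ g) :* h :+ (x :+ y) := f :* h :+ x :+ (g :* h :+ y)) ≡.refl
      (f 0) (g 0) (h (suc n)) (((f ∘ suc) ⊛ h) n) (((g ∘ suc) ⊛ h) n))

  ⊛-scale : ∀ c f g n → ((λ k → c ℤ.* f k) ⊛ g) n ≡ c ℤ.* (f ⊛ g) n
  ⊛-scale c f g zero    = ℤ.*-assoc c (f 0) (g 0)
  ⊛-scale c f g (suc n) = ≡.trans (≡.cong (ℤ._+_ (c ℤ.* f 0 ℤ.* g (suc n))) (⊛-scale c (f ∘ suc) g n))
    (solve 4 (λ c f g x → c :* f :* g :+ c :* x := c :* (f :* g :+ x)) ≡.refl c (f 0) (g (suc n)) (((f ∘ suc) ⊛ g) n))

  -- The mirror image of the defining recursion, peeling off g in place of f; the two together give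
  -- commutativity.
  ⊛-tailʳ : ∀ f g n → (f ⊛ g) (suc n) ≡ f (suc n) ℤ.* g 0 ℤ.+ (f ⊛ (g ∘ suc)) n
  ⊛-tailʳ f g zero    = ℤ.+-comm (f 0 ℤ.* g 1) (f 1 ℤ.* g 0)
  ⊛-tailʳ f g (suc n) = ≡.trans (≡.cong (ℤ._+_ (f 0 ℤ.* g (suc (suc n)))) (⊛-tailʳ (f ∘ suc) g n))
    (solve 3 (λ a b c → a :+ (b :+ c) := b :+ (a :+ c)) ≡.refl
      (f 0 ℤ.* g (suc (suc n))) (f (suc (suc n)) ℤ.* g 0) (((f ∘ suc) ⊛ (g ∘ suc)) n))

  ⊛-comm : ∀ f g n → (f ⊛ g) n ≡ (g ⊛ f) n
  ⊛-comm f g zero    = ℤ.*-comm (f 0) (g 0)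
  ⊛-comm f g (suc n) = ≡.trans (≡.cong₂ ℤ._+_ (ℤ.*-comm (f 0) (g (suc n))) (⊛-comm (f ∘ suc) g n))
    (≡.sym (⊛-tailʳ g f n))

  ⊛-assoc : ∀ f g h n → ((f ⊛ g) ⊛ h) n ≡ (f ⊛ (g ⊛ h)) n
  ⊛-assoc f g h zero    = ℤ.*-assoc (f 0) (g 0) (h 0)
  ⊛-assoc f g h (suc n) = begin
    f 0 ℤ.* g 0 ℤ.* h (suc n) ℤ.+ (((λ k → f 0 ℤ.* g (suc k)) ⊕ ((f ∘ suc) ⊛ g)) ⊛ h) n
      ≡⟨ ≡.cong (ℤ._+_ (f 0 ℤ.* g 0 ℤ.* h (suc n))) (⊛-distribʳ h (λ k → f 0 ℤ.* g (suc k)) ((f ∘ suc) ⊛ g) n) ⟩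
    f 0 ℤ.* g 0 ℤ.* h (suc n) ℤ.+ (((λ k → f 0 ℤ.* g (suc k)) ⊛ h) n ℤ.+ (((f ∘ suc) ⊛ g) ⊛ h) n)
      ≡⟨ ≡.cong (ℤ._+_ (f 0 ℤ.* g 0 ℤ.* h (suc n))) (≡.cong₂ ℤ._+_ (⊛-scale (f 0) (g ∘ suc) h n) (⊛-assoc (f ∘ suc) g h n)) ⟩
    f 0 ℤ.* g 0 ℤ.* h (suc n) ℤ.+ (f 0 ℤ.* ((g ∘ suc) ⊛ h) n ℤ.+ ((f ∘ suc) ⊛ (g ⊛ h)) n)
      ≡⟨ solve 5 (λ f g h x y → f :* g :* h :+ (f :* x :+ y) := f :* (g :* h :+ x) :+ y) ≡.refl
           (f 0) (g 0) (h (suc n)) (((g ∘ suc) ⊛ h) n) (((f ∘ suc) ⊛ (g ⊛ h)) n) ⟩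
    (f ⊛ (g ⊛ h)) (suc n) ∎

  X-⊛ : ∀ f n → (X ⊛ f) (suc n) ≡ f n
  X-⊛ f n = ≡.trans (ℤ.+-identityˡ (((X ∘ suc) ⊛ f) n)) (⊛-identityˡ f n)

-- ℤ[[q]]/(q^N) on the carrier of all series: only the equality is truncated. The product respects
-- it because its coefficient at n involves no coefficients beyond n.
truncated : ℕ → CommutativeSemiring 0ℓ 0ℓ
truncated N = record
  { Carrier = Series
  ; _≈_     = λ f g → ∀ n → n < N → f n ≡ g n
  ; _+_     = _⊕_
  ; _*_     = _⊛_
  ; 0#      = constant 0ℤ
  ; 1#      = constant 1ℤ
  ; isCommutativeSemiring = IsCommutativeSemiringˡ.isCommutativeSemiring record
    { +-isCommutativeMonoid = record
      { isMonoid = record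
        { isSemigroup = record
          { isMagma = record
            { isEquivalence = isEquivalence
            ; ∙-cong = λ f≈ g≈ n n<N → ≡.cong₂ ℤ._+_ (f≈ n n<N) (g≈ n n<N)
            }
          ; assoc = λ f g h n _ → ℤ.+-assoc (f n) (g n) (h n)
          }
        ; identity = (λ f n _ → ≡.trans (≡.cong (ℤ._+ f n) (constant-0 n)) (ℤ.+-identityˡ (f n)))
                   , (λ f n _ → ≡.trans (≡.cong (ℤ._+_ (f n)) (constant-0 n)) (ℤ.+-identityʳ (f n)))
        }
      ; comm = λ f g n _ → ℤ.+-comm (f n) (g n)
      }
    ; *-isCommutativeMonoid = record
      { isMonoid = record
        { isSemigroup = record
          { isMagma = record
            { isEquivalence = isEquivalence
            ; ∙-cong = λ f≈ g≈ n n<N → ⊛-cong n (λ k k≤n → f≈ k (ℕ.≤-<-trans k≤n n<N)) (λ k k≤n → g≈ k (ℕ.≤-<-trans k≤n n<N))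
            }
          ; assoc = λ f g h n _ → ⊛-assoc f g h n
          }
        ; identity = (λ f n _ → ⊛-identityˡ f n)
                   , (λ f n _ → ≡.trans (⊛-comm f (constant 1ℤ) n) (⊛-identityˡ f n))
        }
      ; comm = λ f g n _ → ⊛-comm f g n
      }
    ; distribʳ = λ h f g n _ → ⊛-distribʳ h f g n
    ; zeroˡ    = λ f n _ → ≡.trans (⊛-zeroˡ f n) (≡.sym (constant-0 n))
    }
  }
  where
  isEquivalence : IsEquivalence (λ (f g : Series) → ∀ n → n < N → f n ≡ g n)
  isEquivalence = record
    { refl  = λ _ _ → ≡.refl
    ; sym   = λ f≈g n n<N → ≡.sym (f≈g n n<N)
    ; trans = λ f≈g g≈h n n<N → ≡.trans (f≈g n n<N) (g≈h n n<N)
    }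

module _ (N : ℕ) where
  open CommutativeSemiring (truncated N) using (_≈_; 0#; 1#; _+_; _*_)
  open Exponent (truncated N)

  X^-⊛-≥ : ∀ k f n → (X ^ k * f) (k ℕ.+ n) ≡ f n
  X^-⊛-≥ zero    f n = ⊛-identityˡ f n
  X^-⊛-≥ (suc k) f n = ≡.trans (⊛-assoc X (X ^ k) f (suc (k ℕ.+ n)))
    (≡.trans (X-⊛ (X ^ k * f) (k ℕ.+ n)) (X^-⊛-≥ k f n))

  X^-⊛-< : ∀ k f n → n < k → (X ^ k * f) n ≡ 0ℤ
  X^-⊛-< (suc k) f zero    _         = ≡.cong (ℤ._* f 0) (ℤ.*-zeroˡ ((X ^ k) 0))
  X^-⊛-< (suc k) f (suc n) (s≤s n<k) = ≡.trans (⊛-assoc X (X ^ k) f (suc n))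
    (≡.trans (X-⊛ (X ^ k * f) n) (X^-⊛-< k f n n<k))

  X^-≢ : ∀ k n → n ≢ k → (X ^ k) n ≡ 0ℤ
  X^-≢ k n n≢k = ≡.trans (≡.sym (≡.trans (⊛-comm (X ^ k) 1# n) (⊛-identityˡ (X ^ k) n))) (go (ℕ.≤-<-connex k n))
    where
    go : k ≤ n ⊎ n < k → (X ^ k * 1#) n ≡ 0ℤ
    go (inj₂ n<k) = X^-⊛-< k 1# n n<k
    go (inj₁ k≤n) with n ∸ k | ℕ.m+[n∸m]≡n k≤n
    ... | zero  | eq     = ⊥-elim (n≢k (≡.trans (≡.sym eq) (ℕ.+-identityʳ k)))
    ... | suc d | ≡.refl = X^-⊛-≥ k 1# (suc d)

  X^N≈0 : X ^ N ≈ 0#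
  X^N≈0 n n<N = ≡.trans (X^-≢ N n (ℕ.<⇒≢ n<N)) (≡.sym (constant-0 n))

  1-1≈0 : 1# + constant -1ℤ ≈ 0#
  1-1≈0 zero    _ = ≡.refl
  1-1≈0 (suc n) _ = ≡.refl

-- Generating functions of partitions

open BigOperator ℕ.+-0-commutativeMonoid

sum-applyUpTo : ∀ n f → sum (applyUpTo f n) ≡ big n f
sum-applyUpTo zero    f = ≡.refl
sum-applyUpTo (suc n) f = ≡.trans (≡.cong (f 0 ℕ.+_) (sum-applyUpTo n (f ∘ suc))) (≡.sym (big-head n f))

-- One unit of fuel is spent per part while the total drops by the whole part, so the recursion
-- accumulates a surplus; `bounded` always takes fuel equal to the total.
partitionsBounded-fuel : ∀ f f′ n m → n ≤ f → n ≤ f′ → partitionsBounded f n m ≡ partitionsBounded f′ n m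
partitionsBounded-fuel _       _        zero    m _         _          = ≡.refl
partitionsBounded-fuel (suc f) (suc f′) (suc n) m (s≤s n≤f) (s≤s n≤f′) =
  List.concatMap-cong (λ k → ≡.cong (map (suc k ∷_))
    (partitionsBounded-fuel f f′ (n ∸ k) (suc k) (ℕ.≤-trans (ℕ.m∸n≤m n k) n≤f) (ℕ.≤-trans (ℕ.m∸n≤m n k) n≤f′)))
    (filter (λ k → T? ((k <ᵇ m) ∧ (k <ᵇ suc n))) (upTo (suc n)))

sum-filter : ∀ (b : ℕ → Bool) (c : ℕ → ℕ) ks →
  sum (map c (filter (λ k → T? (b k)) ks)) ≡ sum (map (λ k → if b k then c k else 0) ks)
sum-filter b c []       = ≡.refl
sum-filter b c (k ∷ ks) with b k
... | true  = ≡.cong (c k ℕ.+_) (sum-filter b c ks)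
... | false = sum-filter b c ks

module PartitionCount (S : NatSet) where

  count : List (List ℕ) → ℕ
  count ps = length (filter (λ p → T? (allB S p)) ps)

  count-++ : ∀ ps qs → count (ps ++ qs) ≡ count ps ℕ.+ count qs
  count-++ ps qs = ≡.trans (≡.cong length (List.filter-++ (λ p → T? (allB S p)) ps qs)) (List.length-++ (filter _ ps))

  count-concatMap : ∀ {A : Set} (h : A → List (List ℕ)) xs → count (concatMap h xs) ≡ sum (map (count ∘ h) xs)
  count-concatMap h []       = ≡.refl
  count-concatMap h (x ∷ xs) = ≡.trans (count-++ (h x) (concatMap h xs)) (≡.cong (count (h x) ℕ.+_) (count-concatMap h xs))

  count-prepend : ∀ k ps → count (map (k ∷_) ps) ≡ (if S k then count ps else 0)
  count-prepend k []       with S k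
  ... | true  = ≡.refl
  ... | false = ≡.refl
  count-prepend k (p ∷ ps) with S k | count-prepend k ps
  ... | false | eq = eq
  ... | true  | eq with allB S p
  ...   | true  = ≡.cong suc eq
  ...   | false = eq

  bounded : ℕ → ℕ → ℕ
  bounded m n = count (partitionsBounded n n m)

  -- The partitions of `suc n`, not of `n`, whose largest part is `suc k`; what remains is n - k.
  largest : ℕ → ℕ → ℕ
  largest n k = if S (suc k) then bounded (suc k) (n ∸ k) else 0

  bounded-sum : ∀ m n → bounded m (suc n) ≡ big (suc n) (λ k → if (k <ᵇ m) ∧ (k <ᵇ suc n) then largest n k else 0)
  bounded-sum m n = begin
    bounded m (suc n)
      ≡⟨ count-concatMap h ks ⟩
    sum (map (count ∘ h) ks)
      ≡⟨ ≡.cong sum (List.map-cong count-h ks) ⟩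
    sum (map (largest n) ks)
      ≡⟨ sum-filter (λ k → (k <ᵇ m) ∧ (k <ᵇ suc n)) (largest n) (upTo (suc n)) ⟩
    sum (map w (upTo (suc n)))
      ≡⟨ ≡.cong sum (List.map-upTo w (suc n)) ⟩
    sum (applyUpTo w (suc n))
      ≡⟨ sum-applyUpTo (suc n) w ⟩
    big (suc n) w ∎
    where
    open ≡.≡-Reasoning
    ks = filter (λ k → T? ((k <ᵇ m) ∧ (k <ᵇ suc n))) (upTo (suc n))
    w : ℕ → ℕ
    w k = if (k <ᵇ m) ∧ (k <ᵇ suc n) then largest n k else 0
    h : ℕ → List (List ℕ)
    h k = map (suc k ∷_) (partitionsBounded n (n ∸ k) (suc k))
    count-h : ∀ k → count (h k) ≡ largest n k
    count-h k = ≡.trans (count-prepend (suc k) (partitionsBounded n (n ∸ k) (suc k)))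
      (≡.cong (λ ps → if S (suc k) then count ps else 0)
        (partitionsBounded-fuel n (n ∸ k) (n ∸ k) (suc k) (ℕ.m∸n≤m n k) ℕ.≤-refl))

  private
    <ᵇ-true : ∀ {k m} → k < m → (k <ᵇ m) ≡ true
    <ᵇ-true k<m = Equivalence.to T-≡ (ℕ.<⇒<ᵇ k<m)

    <ᵇ-false : ∀ {k m} → m ≤ k → (k <ᵇ m) ≡ false
    <ᵇ-false {k} {m} m≤k with k <ᵇ m in eq
    ... | false = ≡.refl
    ... | true  = ⊥-elim (ℕ.<⇒≱ (ℕ.<ᵇ⇒< k m (≡.subst Bool.T (≡.sym eq) _)) m≤k)

  bounded-≤ : ∀ {m n} → m ≤ suc n → bounded m (suc n) ≡ big m (largest n)
  bounded-≤ {m} {n} m≤1+n = ≡.trans (bounded-sum m n) (≡.subst (λ l → big l w ≡ big m (largest n)) (ℕ.m+[n∸m]≡n m≤1+n)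
    (≡.trans (big-prefix m (suc n ∸ m) w (λ i → ≡.cong (λ b → if b ∧ (m ℕ.+ i <ᵇ suc n) then largest n (m ℕ.+ i) else 0) (<ᵇ-false (ℕ.m≤m+n m i))))
             (big-cong m (λ k k<m → ≡.cong₂ (λ b b′ → if b ∧ b′ then largest n k else 0) (<ᵇ-true k<m) (<ᵇ-true (ℕ.<-≤-trans k<m m≤1+n))))))
    where
    w : ℕ → ℕ
    w k = if (k <ᵇ m) ∧ (k <ᵇ suc n) then largest n k else 0

  bounded-≥ : ∀ {m n} → suc n ≤ m → bounded m (suc n) ≡ big (suc n) (largest n)
  bounded-≥ {m} {n} 1+n≤m = ≡.trans (bounded-sum m n)
    (big-cong (suc n) (λ k k<1+n → ≡.cong₂ (λ b b′ → if b ∧ b′ then largest n k else 0) (<ᵇ-true (ℕ.<-≤-trans k<1+n 1+n≤m)) (<ᵇ-true k<1+n)))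

  bounded-stable : ∀ {m n} → n ≤ m → bounded m n ≡ p S n
  bounded-stable {n = zero}  _     = ≡.refl
  bounded-stable {n = suc n} 1+n≤m = ≡.trans (bounded-≥ 1+n≤m) (≡.sym (bounded-≥ ℕ.≤-refl))

  -- Sorted by largest part, the two bounded counts differ by the single summand with largest part
  -- `suc m`. Writing the total as suc m + n avoids a difference.
  bounded-suc : ∀ m n → bounded (suc m) (suc m ℕ.+ n) ≡ bounded m (suc m ℕ.+ n) ℕ.+ (if S (suc m) then bounded (suc m) n else 0)
  bounded-suc m n = ≡.trans (bounded-≤ (s≤s (ℕ.m≤m+n m n)))
    (≡.cong₂ ℕ._+_ (≡.sym (bounded-≤ (ℕ.m≤n⇒m≤1+n (ℕ.m≤m+n m n))))
                   (≡.cong (λ k → if S (suc m) then bounded (suc m) k else 0) (ℕ.m+n∸m≡n m n)))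

-- The representatives run over 1, ..., 60, so that each is the least positive member of its class,
-- the exponent at which φ starts.
residues : List ℕ → List ℕ
residues rs = filter (λ r → T? (pm60 rs r)) (applyUpTo suc 60)

pm60-periodic : ∀ rs j i → pm60 rs (suc (j ℕ.* 60 ℕ.+ i)) ≡ pm60 rs (suc i)
pm60-periodic rs j i = ≡.cong (λ m → anyB (λ r → (m ≡ᵇ r ℕ.% 60) ∨ (m ≡ᵇ (60 ∸ (r ℕ.% 60)) ℕ.% 60)) rs)
  (≡.trans (≡.cong (λ x → suc x ℕ.% 60) (ℕ.+-comm (j ℕ.* 60) i)) (ℕ.[m+kn]%n≡m%n (suc i) j 60))

module GeneratingFunction (N : ℕ) where
  open CommutativeSemiring (truncated N)
  open Exponent (truncated N)
  ν : Series
  ν = constant -1ℤ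
  open Nilpotent (truncated N) ν (1-1≈0 N) N using (∑; ∏; cancel-ν; module Product)
  open Products (truncated N) ν (1-1≈0 N) N X (X^N≈0 N) public
  open SetoidReasoning setoid
  open NaturalSolver (truncated N) using (solve; _:=_; _:+_; _:*_; con)

  P : NatSet → Series
  P S n = + p S n

  module _ (S : NatSet) where
    open PartitionCount S

    factor : ℕ → Series
    factor k = if S (suc k) then 1# + ν * X ^ suc k else 1#

    B : ℕ → Series
    B m n = + bounded m n

    -- In degrees from `suc m` on this is `bounded-suc`; in lower degrees neither bound restricts
    -- the parts, and the multiple of X^(m+1) contributes nothing.
    B-suc : ∀ m → B (suc m) ≈ B m + (if S (suc m) then X ^ suc m * B (suc m) else 0#)
    B-suc m n _ with ℕ.≤-<-connex (suc m) n
    ... | inj₁ 1+m≤n with n ∸ suc m | ℕ.m+[n∸m]≡n 1+m≤n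
    ...   | d | ≡.refl = ≡.trans (≡.cong +_ (bounded-suc m d)) (≡.cong (ℤ._+_ (B m (suc m ℕ.+ d))) select)
      where
      select : + (if S (suc m) then bounded (suc m) d else 0) ≡ (if S (suc m) then X ^ suc m * B (suc m) else 0#) (suc m ℕ.+ d)
      select with S (suc m)
      ... | true  = ≡.sym (X^-⊛-≥ N (suc m) (B (suc m)) d)
      ... | false = ≡.refl
    B-suc m n _ | inj₂ n<1+m = ≡.trans (≡.cong +_ (≡.trans (bounded-stable (ℕ.<⇒≤ n<1+m)) (≡.sym (bounded-stable (ℕ.≤-pred n<1+m)))))
      (≡.trans (≡.sym (ℤ.+-identityʳ _)) (≡.cong (ℤ._+_ (B m n)) select))
      where
      select : 0ℤ ≡ (if S (suc m) then X ^ suc m * B (suc m) else 0#) n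
      select with S (suc m)
      ... | true  = ≡.sym (X^-⊛-< N (suc m) (B (suc m)) n n<1+m)
      ... | false = ≡.sym (constant-0 n)

    factor-B : ∀ m → factor m * B (suc m) ≈ B m
    factor-B m with S (suc m) | B-suc m
    ... | true  | eq = begin
      (1# + ν * X ^ suc m) * B (suc m)
        ≈⟨ solve 3 (λ v x b → (con 1 :+ v :* x) :* b := b :+ v :* (x :* b)) refl ν (X ^ suc m) (B (suc m)) ⟩
      B (suc m) + ν * (X ^ suc m * B (suc m))
        ≈⟨ +-congʳ eq ⟩
      B m + X ^ suc m * B (suc m) + ν * (X ^ suc m * B (suc m))
        ≈⟨ solve 3 (λ v b y → b :+ y :+ v :* y := b :+ (con 1 :+ v) :* y) refl ν (B m) (X ^ suc m * B (suc m)) ⟩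
      B m + (1# + ν) * (X ^ suc m * B (suc m))
        ≈⟨ cancel-ν (B m) _ ⟩
      B m ∎
    ... | false | eq = trans (*-identityˡ _) (trans eq (+-identityʳ _))

    -- Telescoping: each factor lowers the bound on the parts by one, down to `B 0`, which counts
    -- only the empty partition.
    ∏-factor : ∀ m → ∏ m factor * B m ≈ 1#
    ∏-factor zero    = trans (*-identityˡ _) B-zero
      where
      B-zero : B 0 ≈ 1#
      B-zero zero    _ = ≡.refl
      B-zero (suc n) _ = ≡.cong +_ (bounded-≤ {0} {n} z≤n)
    ∏-factor (suc m) = trans (*-assoc _ _ _) (trans (*-congˡ (factor-B m)) (∏-factor m))

    ∏-filter : ∀ n f → ∏ n (λ i → if S (f i) then φ (f i) else 1#) ≈ monomial (filter (λ r → T? (S r)) (applyUpTo f n))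
    ∏-filter zero    f = refl
    ∏-filter (suc n) f = trans (Product.big-head n (λ i → if S (f i) then φ (f i) else 1#)) (trans (*-congˡ (∏-filter n (f ∘ suc))) head)
      where
      rest = monomial (filter (λ r → T? (S r)) (applyUpTo (f ∘ suc) n))
      head : (if S (f 0) then φ (f 0) else 1#) * rest ≈ monomial (filter (λ r → T? (S r)) (applyUpTo f (suc n)))
      head with S (f 0)
      ... | true  = refl
      ... | false = *-identityˡ rest

    -- The factors form N rows of length 60; multiplied column by column, each residue in `S` yields
    -- one φ.
    ∏-factor-periodic : (∀ j i → S (suc (j ℕ.* 60 ℕ.+ i)) ≡ S (suc i)) →
      ∏ (N ℕ.* 60) factor ≈ monomial (filter (λ r → T? (S r)) (applyUpTo suc 60))
    ∏-factor-periodic periodic = begin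
      ∏ (N ℕ.* 60) factor
        ≈⟨ Product.big-blocks N 60 factor ⟩
      ∏ N (λ j → ∏ 60 (λ i → factor (j ℕ.* 60 ℕ.+ i)))
        ≈⟨ Product.big-swap N 60 (λ j i → factor (j ℕ.* 60 ℕ.+ i)) ⟩
      ∏ 60 (λ i → ∏ N (λ j → factor (j ℕ.* 60 ℕ.+ i)))
        ≈⟨ Product.big-cong′ 60 column ⟩
      ∏ 60 (λ i → if S (suc i) then φ (suc i) else 1#)
        ≈⟨ ∏-filter 60 suc ⟩
      monomial (filter (λ r → T? (S r)) (applyUpTo suc 60)) ∎
      where
      column : ∀ i → ∏ N (λ j → factor (j ℕ.* 60 ℕ.+ i)) ≈ (if S (suc i) then φ (suc i) else 1#)
      column i = trans (Product.big-cong′ N (λ j → reflexive (≡.cong₂ (λ b x → if b then 1# + ν * X ^ suc x else 1#) (periodic j i) (ℕ.+-comm (j ℕ.* 60) i)))) collapse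
        where
        collapse : ∏ N (λ j → if S (suc i) then 1# + ν * X ^ (suc i ℕ.+ j ℕ.* 60) else 1#) ≈ (if S (suc i) then φ (suc i) else 1#)
        collapse with S (suc i)
        ... | true  = refl
        ... | false = Product.big-ε N (λ _ _ → refl)

  generating-function : ∀ rs → monomial (residues rs) * P (pm60 rs) ≈ 1#
  generating-function rs = begin
    monomial (residues rs) * P S
      ≈⟨ *-cong (∏-factor-periodic S (pm60-periodic rs)) B≈P ⟨
    ∏ (N ℕ.* 60) (factor S) * B S (N ℕ.* 60)
      ≈⟨ ∏-factor S (N ℕ.* 60) ⟩
    1# ∎
    where
    S = pm60 rs
    open PartitionCount S using (bounded-stable)
    B≈P : B S (N ℕ.* 60) ≈ P S
    -- A bound of 60N on the parts is no restriction for totals below N.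
    B≈P n n<N = ≡.cong +_ (bounded-stable (ℕ.≤-trans (ℕ.<⇒≤ n<N) (ℕ.m≤m*n N 60)))

  module _ (rs ts : List ℕ) (e : ℕ) where
    private
      s = monomial (residues rs)
      t = monomial (residues ts)
      F = P (pm60 rs)
      G = P (pm60 ts)
      st≈ : monomial (residues rs ++ residues ts) ≈ s * t
      st≈ = monomial-++ (residues rs) (residues ts)

    shifted : 1 ≤ e → monomial (residues rs ++ residues ts) + X ^ e * s ≈ t →
      ∀ n → n < N → e ≤ n → p (pm60 rs) n ≡ p (pm60 ts) (n ∸ e)
    shifted 1≤e eq n n<N e≤n = ℤ.+-injective (≡.trans (≡.sym (1+X^eG≈F n n<N))
      -- The summand 1 affects only the coefficient at 0, and 1 ≤ e ≤ n.
      (≡.trans (≡.cong₂ ℤ._+_ (one n (ℕ.≤-trans 1≤e e≤n)) coefficient) (ℤ.+-identityˡ _)))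
      where
      1+X^eG≈F : 1# + X ^ e * G ≈ F
      1+X^eG≈F = shifted-inverses {s} {t} {F} {G} {X ^ e} (generating-function rs) (generating-function ts)
        (trans (+-congʳ {X ^ e * s} (sym st≈)) eq)
      one : ∀ n → 1 ≤ n → constant 1ℤ n ≡ 0ℤ
      one (suc n) _ = ≡.refl
      coefficient : (X ^ e * G) n ≡ + p (pm60 ts) (n ∸ e)
      coefficient with n ∸ e | ℕ.m+[n∸m]≡n e≤n
      ... | d | ≡.refl = X^-⊛-≥ N e G d

    shiftless : s + X ^ e * monomial (residues rs ++ residues ts) ≈ t →
      ∀ n → n < N → n ≢ e → p (pm60 rs) n ≡ p (pm60 ts) n
    shiftless eq n n<N n≢e = ℤ.+-injective (≡.trans (≡.sym (G+X^e≈F n n<N))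
      (≡.trans (≡.cong (ℤ._+_ (G n)) (X^-≢ N e n n≢e)) (ℤ.+-identityʳ (G n))))
      where
      G+X^e≈F : G + X ^ e ≈ F
      G+X^e≈F = shiftless-inverses {s} {t} {F} {G} {X ^ e} (generating-function rs) (generating-function ts)
        (trans (+-congˡ {s} (*-congˡ {X ^ e} (sym st≈))) eq)

-- The four identities as instances of the three-term relation

open GeneratingFunction using (shifted; shiftless; reduced-three-term)

theorem12p2 : ((n : ℕ) → 1 ≤ n →
    p (pm60 (1 ∷ 5 ∷ 6 ∷ 8 ∷ 9 ∷ 13 ∷ 17 ∷ 21 ∷ 22 ∷ 25 ∷ 28 ∷ 29 ∷ [])) n
    ≡ p (pm60 (1 ∷ 4 ∷ 5 ∷ 7 ∷ 13 ∷ 16 ∷ 17 ∷ 22 ∷ 23 ∷ 25 ∷ 26 ∷ 29 ∷ [])) (n ∸ 1))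
    × ((n : ℕ) → n ≢ 2 →
    p (pm60 (1 ∷ 2 ∷ 5 ∷ 7 ∷ 8 ∷ 11 ∷ 19 ∷ 23 ∷ 25 ∷ 26 ∷ 28 ∷ 29 ∷ [])) n
    ≡ p (pm60 (1 ∷ 3 ∷ 4 ∷ 5 ∷ 7 ∷ 16 ∷ 18 ∷ 23 ∷ 25 ∷ 26 ∷ 27 ∷ 29 ∷ [])) n)
    × ((n : ℕ) → n ≢ 4 →
    p (pm60 (2 ∷ 4 ∷ 5 ∷ 7 ∷ 11 ∷ 13 ∷ 14 ∷ 16 ∷ 17 ∷ 19 ∷ 23 ∷ 25 ∷ [])) n
    ≡ p (pm60 (2 ∷ 5 ∷ 6 ∷ 7 ∷ 8 ∷ 9 ∷ 11 ∷ 19 ∷ 21 ∷ 23 ∷ 25 ∷ 28 ∷ [])) n)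
    × ((n : ℕ) → 3 ≤ n →
    p (pm60 (3 ∷ 4 ∷ 5 ∷ 11 ∷ 13 ∷ 14 ∷ 16 ∷ 17 ∷ 18 ∷ 19 ∷ 25 ∷ 27 ∷ [])) n
    ≡ p (pm60 (1 ∷ 5 ∷ 8 ∷ 11 ∷ 13 ∷ 14 ∷ 17 ∷ 19 ∷ 22 ∷ 25 ∷ 28 ∷ 29 ∷ [])) (n ∸ 3))
-- The signs and the sᵢ were found by a computer search.
theorem12p2 =
    -- The coefficient at n is read off modulo q^(n+1). In all four cases the shift is s₂ - s₃, here
    -- 5 - 4.
    (λ n → shifted (suc n) S₁ T₁ 1 (s≤s z≤n)
      (reduced-three-term (suc n) Sign.+ 9 5 4 3 (residues S₁ ++ residues T₁) (residues S₁) (residues T₁) ≡.refl ≡.refl ≡.refl) n ℕ.≤-refl)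
  -- Now Φ_S Φ_T is the term that carries the power of q, and Φ_S the one without it.
  , (λ n → shiftless (suc n) S₂ T₂ 2
      (reduced-three-term (suc n) Sign.- 9 5 3 2 (residues S₂) (residues S₂ ++ residues T₂) (residues T₂) ≡.refl ≡.refl ≡.refl) n ℕ.≤-refl)
  , (λ n → shiftless (suc n) S₃ T₃ 4
      (reduced-three-term (suc n) Sign.- 12 10 6 1 (residues S₃) (residues S₃ ++ residues T₃) (residues T₃) ≡.refl ≡.refl ≡.refl) n ℕ.≤-refl)
  , (λ n → shifted (suc n) S₄ T₄ 3 (s≤s z≤n)
      (reduced-three-term (suc n) Sign.+ 9 8 5 3 (residues S₄ ++ residues T₄) (residues S₄) (residues T₄) ≡.refl ≡.refl ≡.refl) n ℕ.≤-refl)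
  where
  S₁ = 1 ∷ 5 ∷ 6 ∷ 8 ∷ 9 ∷ 13 ∷ 17 ∷ 21 ∷ 22 ∷ 25 ∷ 28 ∷ 29 ∷ []
  T₁ = 1 ∷ 4 ∷ 5 ∷ 7 ∷ 13 ∷ 16 ∷ 17 ∷ 22 ∷ 23 ∷ 25 ∷ 26 ∷ 29 ∷ []
  S₂ = 1 ∷ 2 ∷ 5 ∷ 7 ∷ 8 ∷ 11 ∷ 19 ∷ 23 ∷ 25 ∷ 26 ∷ 28 ∷ 29 ∷ []
  T₂ = 1 ∷ 3 ∷ 4 ∷ 5 ∷ 7 ∷ 16 ∷ 18 ∷ 23 ∷ 25 ∷ 26 ∷ 27 ∷ 29 ∷ []
  S₃ = 2 ∷ 4 ∷ 5 ∷ 7 ∷ 11 ∷ 13 ∷ 14 ∷ 16 ∷ 17 ∷ 19 ∷ 23 ∷ 25 ∷ []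
  T₃ = 2 ∷ 5 ∷ 6 ∷ 7 ∷ 8 ∷ 9 ∷ 11 ∷ 19 ∷ 21 ∷ 23 ∷ 25 ∷ 28 ∷ []
  S₄ = 3 ∷ 4 ∷ 5 ∷ 11 ∷ 13 ∷ 14 ∷ 16 ∷ 17 ∷ 18 ∷ 19 ∷ 25 ∷ 27 ∷ []
  T₄ = 1 ∷ 5 ∷ 8 ∷ 11 ∷ 13 ∷ 14 ∷ 17 ∷ 19 ∷ 22 ∷ 25 ∷ 28 ∷ 29 ∷ []
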